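{- Let $R$ and $S$ be connected graphs, each with at least three vertices, with $R,S\neq P_3$. Then the statement "every connected $\{R,S\}$-$o_{ -1}$-heavy graph is traceable" holds if and only if $\{R,S\}=\{K_{1,3},C_3\}$.
   Context: All graphs are finite and simple; $d(v)$ is the degree of $v$ in $G$. $P_3$ is the path on 3 vertices, $C_3$ the triangle, $K_{1,3}$ the claw. A graph is traceable if it contains a path through all its vertices. For a graph $H$, a graph $G$ on $n$ vertices is $H$-$o_{ -1}$-heavy if every induced subgraph of $G$ isomorphic to $H$ contains two nonadjacent vertices whose degree sum in $G$ is at least $n-1$; $G$ is $\{R,S\}$-$o_{ -1}$-heavy if it is both $R$-$o_{ -1}$-heavy and $S$-$o_{ -1}$-heavy. -}

module Defs where

open import Data.Nat using (ℕ; zero; suc; _+_; _∸_; _≤_)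
open import Data.Bool using (Bool; true; false; not; if_then_else_; _xor_)
open import Data.Fin using (Fin; zero; suc)
open import Data.Fin.Properties using (_≟_)
open import Data.List using (List; map; allFin)
open import Data.Nat.ListAction using (sum)
open import Data.List.Membership.Propositional using (_∈_)
open import Data.List.Relation.Unary.Unique.Propositional using (Unique)
open import Data.List.Relation.Unary.Linked using (Linked)
open import Data.Product using (Σ; _×_; _,_; ∃₂)
open import Relation.Nullary using (¬_; does)
open import Relation.Binary.PropositionalEquality using (_≡_; refl; _≢_)

record Graph : Set where
  field
    n      : ℕ
    adj    : Fin n → Fin n → Bool
    sym    : ∀ u v → adj u v ≡ adj v u
    irrefl : ∀ v → adj v v ≡ false
open Graph public

deg : (G : Graph) → Fin (n G) → ℕ
deg G v = sum (map (λ w → if adj G v w then 1 else 0) (allFin (n G)))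

data Reach (G : Graph) (u : Fin (n G)) : Fin (n G) → Set where
  here : Reach G u u
  step : ∀ {v w} → Reach G u v → adj G v w ≡ true → Reach G u w

Connected : Graph → Set
Connected G = ∀ u v → Reach G u v

Traceable : Graph → Set
Traceable G = Σ (List (Fin (n G))) λ p →
  Unique p × (∀ v → v ∈ p) × Linked (λ a b → adj G a b ≡ true) p

Iso : Graph → Graph → Set
Iso G H = Σ (Fin (n G) → Fin (n H)) λ f → Σ (Fin (n H) → Fin (n G)) λ g →
  (∀ x → g (f x) ≡ x) × (∀ y → f (g y) ≡ y) ×
  (∀ u v → adj H (f u) (f v) ≡ adj G u v)

InducedCopy : Graph → Graph → Set
InducedCopy H G = Σ (Fin (n H) → Fin (n G)) λ f →
  (∀ x y → f x ≡ f y → x ≡ y) × (∀ u v → adj G (f u) (f v) ≡ adj H u v)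

Heavy : Graph → Graph → Set
Heavy H G = (c : InducedCopy H G) → let f = Data.Product.proj₁ c in
  ∃₂ λ (u v : Fin (n H)) → u ≢ v × adj G (f u) (f v) ≡ false ×
    n G ∸ 1 ≤ deg G (f u) + deg G (f v)

isZero : ∀ {m} → Fin m → Bool
isZero zero = true
isZero (suc _) = false

xor-comm : ∀ a b → a xor b ≡ b xor a
xor-comm true true = refl
xor-comm true false = refl
xor-comm false true = refl
xor-comm false false = refl

xor-self : ∀ a → a xor a ≡ false
xor-self true = refl
xor-self false = refl

star : ℕ → Graph
star k = record
  { n = suc k
  ; adj = λ i j → isZero i xor isZero j
  ; sym = λ i j → xor-comm (isZero i) (isZero j)
  ; irrefl = λ i → xor-self (isZero i)
  }

K13 : Graph
K13 = star 3

P3 : Graph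
P3 = star 2

neq : ∀ {m} → Fin m → Fin m → Bool
neq i j = not (does (i ≟ j))

neq-sym : ∀ {m} (i j : Fin m) → neq i j ≡ neq j i
neq-sym zero zero = refl
neq-sym zero (suc j) = refl
neq-sym (suc i) zero = refl
neq-sym (suc i) (suc j) with i ≟ j | j ≟ i
... | Relation.Nullary.yes _ | Relation.Nullary.yes _ = refl
... | Relation.Nullary.no _ | Relation.Nullary.no _ = refl
... | Relation.Nullary.yes p | Relation.Nullary.no q = Data.Empty.⊥-elim (q (Relation.Binary.PropositionalEquality.sym p))
  where import Data.Empty
... | Relation.Nullary.no p | Relation.Nullary.yes q = Data.Empty.⊥-elim (p (Relation.Binary.PropositionalEquality.sym q))
  where import Data.Empty

neq-irr : ∀ {m} (i : Fin m) → neq i i ≡ false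
neq-irr zero = refl
neq-irr (suc i) with i ≟ i
... | Relation.Nullary.yes _ = refl
... | Relation.Nullary.no p = Data.Empty.⊥-elim (p refl)
  where import Data.Empty

complete : ℕ → Graph
complete m = record { n = m ; adj = neq ; sym = neq-sym ; irrefl = neq-irr }

C3 : Graph
C3 = complete 3

-- Sufficiency.  Let G be connected, triangle-free and claw-o₋₁-heavy, and let v have maximum degree k.  If k ≤ 2, a path
-- that does not cover G can be prolonged at one of its ends.  If k ≥ 3, two neighbours x, y of v have
-- d(x) + d(y) ≥ n − 1, say d(y) ≤ d(x).  Since N(v) and N(x) are disjoint and d(x) ≤ k, either they cover V and
-- d(x) ∈ {k − 1, k}, or they miss exactly one vertex w and d(x) = k.  Both sets are independent, and heaviness of the
-- claws makes all but at most two vertices of N(v) adjacent to (almost) all of N(x).  A Hamiltonian path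
-- then alternates between the two sets, with the few exceptional vertices near its ends.
--
-- Necessity.  K₁,₃ is not traceable, and its only connected induced subgraphs on at least three vertices are P₃ and K₁,₃;
-- so one of R and S is K₁,₃.  Call the other one S.  A complete S with at least four vertices is excluded by the net,
-- which has neither claws nor K₄.  A noncomplete S with at least four vertices contains an induced P₃ and a further vertex
-- attached to it, and is excluded by an untraceable graph on 39 vertices in which every such configuration is heavy.
module Submission where

open import Defs hiding (sym)
import Algebra.Solver.CommutativeMonoid as CMSolver
open import Data.Bool as Bool using (Bool; true; false; if_then_else_; _∧_; _∨_)
open import Data.Bool.Properties using (∨-comm; ¬-not; not-¬)
open import Data.Empty using (⊥; ⊥-elim)
open import Data.Fin using (Fin; zero; suc; toℕ; inject≤; finToFun; funToFin; #_)
open import Data.Fin.Patterns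
open import Data.Fin.Properties using (_≟_; all?; any?; ¬∀⟶∃¬; injective⇒≤; inject≤-injective; finToFun-funToFin)
open import Data.List using (List; []; _∷_; [_]; _++_; length; filter; allFin; map; _∷ʳ_; initLast; _∷ʳ′_)
open import Data.List.Extrema.Nat using (argmax; f[xs]≤f[argmax])
import Data.List.Membership.DecPropositional as DecMembership
open import Data.List.Membership.Propositional using (_∈_)
open import Data.List.Membership.Propositional.Properties
open import Data.List.Properties using (length-++; length-map; length-tabulate; ++-assoc; ∷-injectiveˡ; ∷ʳ-injectiveʳ)
open import Data.List.Relation.Binary.Permutation.Propositional using (_↭_; ↭-refl; ↭-sym; ↭-trans; ↭-reflexive; prep; swap; ↭⇒↭ₛ)
open import Data.List.Relation.Binary.Permutation.Propositional.Properties hiding (++-assoc)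
import Data.List.Relation.Binary.Permutation.Setoid.Properties as Permₛ
open import Data.List.Relation.Unary.All as All using (All; []; _∷_)
open import Data.List.Relation.Unary.AllPairs using ([]; _∷_)
open import Data.List.Relation.Unary.Any using (here; there)
open import Data.List.Relation.Unary.Linked using (Linked; []; [-]; _∷_)
open import Data.List.Relation.Unary.Unique.Propositional using (Unique)
import Data.List.Relation.Unary.Unique.Propositional.Properties as Uniq
open import Data.Nat as ℕ using (ℕ; zero; suc; _+_; _∸_; _≤_; z≤n; s≤s; _≤?_)
open import Data.Nat.ListAction using (sum)
open import Data.Nat.Properties hiding (_≟_)
open import Data.Nat.Tactic.RingSolver using (solve-∀)
open import Data.Product using (∃; ∃₂; _×_; _,_; proj₁; proj₂)
open import Data.Sum using (_⊎_; inj₁; inj₂)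
open import Data.Unit using (tt)
open import Data.Vec as Vec using (Vec; lookup; replicate)
open import Function using (_∘_; id)
open import Function.Bundles using (_⇔_; mk⇔)
open import Relation.Binary.PropositionalEquality as ≡ using (_≡_; _≢_; refl; sym; trans; cong; cong₂; subst)
open import Relation.Nullary using (¬_; Dec; yes; no)
open import Relation.Nullary.Decidable using (_×-dec_; _⊎-dec_; _→-dec_; ¬?; toWitness; map′)
open import Relation.Unary using (Decidable)

-- Lists without repetitions

module PermSolver {A : Set} = CMSolver (++-commutativeMonoid {A = A})

module _ {A : Set} where

  Unique-resp-↭ : {xs ys : List A} → xs ↭ ys → Unique xs → Unique ys
  Unique-resp-↭ = Permₛ.Unique-resp-↭ (≡.setoid A) ∘ ↭⇒↭ₛ

  ∈⇒↭ : {x : A} {ys : List A} → x ∈ ys → ∃ λ zs → ys ↭ x ∷ zs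
  ∈⇒↭ x∈ys with xs , zs , refl ← ∈-∃++ x∈ys = xs ++ zs , shift _ xs zs

  ∈-tail : {x y : A} {xs : List A} → x ≢ y → y ∈ x ∷ xs → y ∈ xs
  ∈-tail x≢y (here y≡x)   = ⊥-elim (x≢y (sym y≡x))
  ∈-tail x≢y (there y∈xs) = y∈xs

  -- The entries of `xs` are taken out of `ys` one at a time; without repetitions each is still
  -- present at its turn. Serves to name the vertices left over once some are singled out.
  complement : {xs ys : List A} → Unique xs → All (_∈ ys) xs → ∃ λ zs → ys ↭ xs ++ zs
  complement [] [] = _ , ↭-refl
  complement {x ∷ xs} {ys} (x≢ ∷ uxs) (x∈ys ∷ xs⊆ys) with ∈⇒↭ x∈ys
  ... | ys′ , p with complement uxs (All.zipWith (λ (x≢y , y∈) → ∈-tail x≢y (∈-resp-↭ p y∈)) (x≢ , xs⊆ys))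
  ... | zs , q = zs , ↭-trans p (prep x q)

  length-⊆ : {xs ys : List A} → Unique xs → All (_∈ ys) xs → length xs ≤ length ys
  length-⊆ {xs} uxs xs⊆ys with zs , p ← complement uxs xs⊆ys =
    ≤-trans (m≤m+n _ _) (≤-reflexive (sym (trans (↭-length p) (length-++ xs))))

  ⊆⇒↭ : {xs ys : List A} → Unique xs → All (_∈ ys) xs → length ys ≤ length xs → ys ↭ xs
  ⊆⇒↭ {xs} uxs xs⊆ys le with complement uxs xs⊆ys
  ... | []     , p = ↭-trans p (++-identityʳ xs)
  ... | z ∷ zs , p = ⊥-elim (m+1+n≰m (length xs)
          (≤-trans (≤-reflexive (sym (trans (↭-length p) (length-++ xs)))) le))

  partition-↭ : {P : A → Set} (P? : Decidable P) (xs : List A) →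
                ∃₂ λ ns ps → xs ↭ ns ++ ps × All (¬_ ∘ P) ns × All P ps
  partition-↭ P? [] = [] , [] , ↭-refl , [] , []
  partition-↭ P? (x ∷ xs) with partition-↭ P? xs | P? x
  ... | ns , ps , q , ¬pns , pps | yes px = ns , x ∷ ps , ↭-trans (prep x q) (↭-sym (shift x ns ps)) , ¬pns , px ∷ pps
  ... | ns , ps , q , ¬pns , pps | no ¬px = x ∷ ns , ps , prep x q , ¬px ∷ ¬pns , pps

  -- The shape in which claw-heaviness is used: a heavy pair among three neighbours of a vertex
  -- passes `P` to both its members.
  TwoOfThree : (A → Set) → List A → Set
  TwoOfThree P xs = ∀ {a b c} → a ∈ xs → b ∈ xs → c ∈ xs → a ≢ b → a ≢ c → b ≢ c →
                    (P a × P b) ⊎ (P a × P c) ⊎ (P b × P c)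

  notBoth : {P : A → Set} {xs : List A} → Unique xs → 3 ≤ length xs → TwoOfThree P xs →
            ∀ {a b} → a ∈ xs → b ∈ xs → a ≢ b → ¬ P a → ¬ P b → ⊥
  notBoth {xs = xs} uxs 3≤ two {a} {b} a∈ b∈ a≢b ¬pa ¬pb
    with complement ((a≢b ∷ []) ∷ [] ∷ []) (a∈ ∷ b∈ ∷ [])
  ... | [] , p = 1+n≰n (subst (3 ≤_) (↭-length p) 3≤)
  ... | c ∷ _ , p with Unique-resp-↭ p uxs
  ... | (_ ∷ a≢c ∷ _) ∷ (b≢c ∷ _) ∷ _
    with two a∈ b∈ (∈-resp-↭ (↭-sym p) (there (there (here refl)))) a≢b a≢c b≢c
  ... | inj₁ (pa , _)        = ¬pa pa
  ... | inj₂ (inj₁ (pa , _)) = ¬pa pa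
  ... | inj₂ (inj₂ (pb , _)) = ¬pb pb

  -- The exceptional entry `z` may satisfy `P` too: if no entry fails, some entry takes its place,
  -- so the paths built later have one shape.
  allButOne : {P : A → Set} → Decidable P → {xs : List A} → Unique xs → 1 ≤ length xs →
              (∀ {a b} → a ∈ xs → b ∈ xs → a ≢ b → ¬ P a → ¬ P b → ⊥) →
              ∃₂ λ z ys → xs ↭ z ∷ ys × All P ys
  allButOne P? {xs} uxs 1≤ excl with partition-↭ P? xs
  ... | [] , [] , p , _ = ⊥-elim (1+n≰n (subst (1 ≤_) (↭-length p) 1≤))
  ... | [] , z ∷ ps , p , _ , _ ∷ pps = z , ps , p , pps
  ... | z ∷ [] , ps , p , _ , pps = z , ps , p , pps
  ... | a ∷ b ∷ _ , _ , p , ¬pa ∷ ¬pb ∷ _ , _ with Unique-resp-↭ p uxs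
  ... | (a≢b ∷ _) ∷ _ = ⊥-elim (excl (∈-resp-↭ (↭-sym p) (here refl)) (∈-resp-↭ (↭-sym p) (there (here refl))) a≢b ¬pa ¬pb)

  allButTwo : {P : A → Set} → Decidable P → {xs : List A} → Unique xs → 2 ≤ length xs →
              (∀ {a b c} → a ∈ xs → b ∈ xs → c ∈ xs → a ≢ b → a ≢ c → b ≢ c → ¬ P a → ¬ P b → ¬ P c → ⊥) →
              ∃ λ y → ∃₂ λ z zs → xs ↭ y ∷ z ∷ zs × All P zs
  allButTwo P? {xs} uxs 2≤ excl with partition-↭ P? xs
  ... | [] , [] , p , _ = ⊥-elim (n≮0 (subst (2 ≤_) (↭-length p) 2≤))
  ... | [] , _ ∷ [] , p , _ = ⊥-elim (1+n≰n (subst (2 ≤_) (↭-length p) 2≤))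
  ... | [] , y ∷ z ∷ ps , p , _ , _ ∷ _ ∷ pps = y , z , ps , p , pps
  ... | y ∷ [] , [] , p , _ = ⊥-elim (1+n≰n (subst (2 ≤_) (↭-length p) 2≤))
  ... | y ∷ [] , z ∷ ps , p , _ , _ ∷ pps = y , z , ps , p , pps
  ... | y ∷ z ∷ [] , ps , p , _ , pps = y , z , ps , p , pps
  ... | a ∷ b ∷ c ∷ _ , _ , p , ¬pa ∷ ¬pb ∷ ¬pc ∷ _ , _ with Unique-resp-↭ p uxs
  ... | (a≢b ∷ a≢c ∷ _) ∷ (b≢c ∷ _) ∷ _ =
    ⊥-elim (excl (in-xs (here refl)) (in-xs (there (here refl))) (in-xs (there (there (here refl)))) a≢b a≢c b≢c ¬pa ¬pb ¬pc)
    where in-xs : ∀ {x} → x ∈ a ∷ b ∷ c ∷ _ → x ∈ xs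
          in-xs = ∈-resp-↭ (↭-sym p)

  -- Meant for lists of equal length; the excess of the longer one is dropped.
  alternate : List A → List A → List A
  alternate (x ∷ xs) (y ∷ ys) = x ∷ y ∷ alternate xs ys
  alternate _        _        = []

  alternate-↭ : (xs ys : List A) → length xs ≡ length ys → alternate xs ys ↭ xs ++ ys
  alternate-↭ []       []       _  = ↭-refl
  alternate-↭ (x ∷ xs) (y ∷ ys) eq =
    prep x (↭-trans (prep y (alternate-↭ xs ys (suc-injective eq))) (↭-sym (shift y xs ys)))

  -- The alternating stretch ends in `c` or in some entry of `ys`, depending on the lengths; hence
  -- `zs` must be attachable to each of these.
  alternate-linked : {E : A → A → Set} → (∀ {x y} → E x y → E y x) → {c : A} (xs ys : List A) {zs : List A} →
                     (∀ {x y} → x ∈ xs → y ∈ c ∷ ys → E x y) → (∀ {y} → y ∈ c ∷ ys → Linked E (y ∷ zs)) →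
                     Linked E (c ∷ alternate xs ys ++ zs)
  alternate-linked E-sym []       _        _    rest = rest (here refl)
  alternate-linked E-sym (x ∷ xs) []       _    rest = rest (here refl)
  alternate-linked E-sym (x ∷ xs) (y ∷ ys) edge rest =
    E-sym (edge (here refl) (here refl)) ∷ edge (here refl) (there (here refl)) ∷
    alternate-linked E-sym xs ys (λ x∈ y∈ → edge (there x∈) (there y∈)) (rest ∘ there)

m+m≤a+b∧b≤m⇒m≤a : ∀ {m a b} → m + m ≤ a + b → b ≤ m → m ≤ a
m+m≤a+b∧b≤m⇒m≤a {m} {a} le b≤m = +-cancelʳ-≤ m m a (≤-trans le (+-monoʳ-≤ a b≤m))

-- Paths

-- Followed backwards from `t`, the walk meets a first vertex with `P`; the edge just traversed is
-- the one sought.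
boundary : (G : Graph) {P : Fin (n G) → Set} → Decidable P → ∀ {s t} → Reach G s t → P s → ¬ P t →
           ∃₂ λ x y → P x × ¬ P y × adj G x y ≡ true
boundary G P? here ps ¬pt = ⊥-elim (¬pt ps)
boundary G P? (step {v} {w} r e) ps ¬pt with P? v
... | yes pv = v , w , pv , ¬pt , e
... | no ¬pv = boundary G P? r ps ¬pv

module Neighbours (G : Graph) where

  V : Set
  V = Fin (n G)

  _~_ : V → V → Set
  u ~ v = adj G u v ≡ true

  ~-sym : ∀ {u v} → u ~ v → v ~ u
  ~-sym {u} {v} e = trans (Graph.sym G v u) e

  ~⇒≢ : ∀ {u v} → u ~ v → u ≢ v
  ~⇒≢ {u} e refl with trans (sym e) (irrefl G u)
  ... | ()

  _~?_ : ∀ u v → Dec (u ~ v)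
  u ~? v = adj G u v Bool.≟ true

  nbrs : V → List V
  nbrs v = filter (v ~?_) (allFin (n G))

  d : V → ℕ
  d v = length (nbrs v)

  deg≡d : ∀ v → deg G v ≡ d v
  deg≡d v = go (allFin (n G))
    where
    go : ∀ ws → sum (map (λ w → if adj G v w then 1 else 0) ws) ≡ length (filter (v ~?_) ws)
    go [] = refl
    go (w ∷ ws) with adj G v w
    ... | true  = cong suc (go ws)
    ... | false = go ws

  nbrs-unique : ∀ v → Unique (nbrs v)
  nbrs-unique v = Uniq.filter⁺ (v ~?_) (Uniq.allFin⁺ (n G))

  ∈-nbrs : ∀ {v w} → v ~ w → w ∈ nbrs v
  ∈-nbrs {v} {w} e = ∈-filter⁺ (v ~?_) (∈-allFin w) e

  nbrs-∈ : ∀ {v w} → w ∈ nbrs v → v ~ w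
  nbrs-∈ {v} w∈ = proj₂ (∈-filter⁻ (v ~?_) {xs = allFin (n G)} w∈)

  length-allFin : length (allFin (n G)) ≡ n G
  length-allFin = length-tabulate id

  ↭⇒traceable : ∀ {p} → Linked _~_ p → allFin (n G) ↭ p → Traceable G
  ↭⇒traceable {p} lp q = p , Unique-resp-↭ q (Uniq.allFin⁺ (n G)) , (λ v → ∈-resp-↭ q (∈-allFin v)) , lp

  3≤d : ∀ {v a b c} → v ~ a → v ~ b → v ~ c → a ≢ b → a ≢ c → b ≢ c → 3 ≤ d v
  3≤d va vb vc a≢b a≢c b≢c =
    length-⊆ ((a≢b ∷ a≢c ∷ []) ∷ (b≢c ∷ []) ∷ [] ∷ []) (∈-nbrs va ∷ ∈-nbrs vb ∷ ∈-nbrs vc ∷ [])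

  linked-snoc : ∀ xs {x y} → Linked _~_ (xs ∷ʳ x) → x ~ y → Linked _~_ ((xs ∷ʳ x) ∷ʳ y)
  linked-snoc []            [-]     e = e ∷ [-]
  linked-snoc (_ ∷ [])      (r ∷ l) e = r ∷ linked-snoc [] l e
  linked-snoc (_ ∷ x ∷ xs)  (r ∷ l) e = r ∷ linked-snoc (x ∷ xs) l e

  linked-mid : ∀ xs {a x b ys} → Linked _~_ (xs ++ a ∷ x ∷ b ∷ ys) → a ~ x × x ~ b
  linked-mid []           (ax ∷ xb ∷ _) = ax , xb
  linked-mid (_ ∷ [])     (_ ∷ l)       = linked-mid [] l
  linked-mid (_ ∷ x ∷ xs) (_ ∷ l)       = linked-mid (x ∷ xs) l

  data Position (p : List V) (x : V) : Set where
    first : ∀ {ys} → p ≡ x ∷ ys → Position p x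
    last  : ∀ {xs} → p ≡ xs ∷ʳ x → Position p x
    inner : ∀ {a b} → a ≢ b → a ∈ p → b ∈ p → a ~ x → x ~ b → Position p x

  -- The two path neighbours of an inner vertex differ because the path has no repetitions. Used
  -- both to prolong paths and to force pendant vertices to the ends.
  position : ∀ {p x} → Unique p → Linked _~_ p → x ∈ p → Position p x
  position {x = x} up lp x∈ with ∈-∃++ x∈
  ... | xs , ys , refl with initLast xs | ys
  ... | []       | _  = first refl
  ... | xs′ ∷ʳ′ a | [] = last {xs = xs′ ∷ʳ a} refl
  ... | xs′ ∷ʳ′ a | b ∷ ys′ with linked-mid xs′ (subst (Linked _~_) (++-assoc xs′ [ a ] (x ∷ b ∷ ys′)) lp)
  ... | ax , xb = inner (a≢b (Unique-resp-↭ shuffle up)) (∈-++⁺ˡ (∈-++⁺ʳ xs′ (here refl)))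
                        (∈-++⁺ʳ (xs′ ∷ʳ a) (there (here refl))) ax xb
    where
    open PermSolver
    shuffle : (xs′ ∷ʳ a) ++ x ∷ b ∷ ys′ ↭ a ∷ b ∷ x ∷ xs′ ++ ys′
    shuffle = solve 5 (λ xs a x b ys → (xs ⊕ a) ⊕ (x ⊕ (b ⊕ ys)) ⊜ a ⊕ (b ⊕ (x ⊕ (xs ⊕ ys))))
                ↭-refl xs′ [ a ] [ x ] [ b ] ys′
    a≢b : ∀ {a b zs} → Unique (a ∷ b ∷ zs) → a ≢ b
    a≢b ((a≢b ∷ _) ∷ _) = a≢b

  module _ (conn : Connected G) where

    open DecMembership (_≟_ {n G}) using (_∈?_)

    -- m bounds the number of vertices outside p.
    extendPath : ∀ m p → Unique p → Linked _~_ p → ∀ {s} → s ∈ p → n G ≤ m + length p →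
                 Traceable G ⊎ ∃ λ v → 3 ≤ d v
    extendPath m p up lp s∈ le with all? (_∈? p)
    ... | yes cover = inj₁ (p , up , cover , lp)
    extendPath m p up lp {s} s∈ le | no ¬cover with ¬∀⟶∃¬ (n G) (_∈ p) (_∈? p) ¬cover
    ... | t , t∉ with boundary G (_∈? p) (conn s t) s∈ t∉
    ... | x , y , x∈ , y∉ , xy with position up lp x∈
    -- Two neighbours on the path and `y` outside it make three.
    ... | inner a≢b a∈ b∈ ax xb = inj₂ (x , 3≤d (~-sym ax) xb xy a≢b (λ { refl → y∉ a∈ }) (λ { refl → y∉ b∈ }))
    extendPath zero p up lp s∈ le | no _ | _ | x , y , x∈ , y∉ , xy | _ =
      ⊥-elim (1+n≰n (≤-trans (length-⊆ (All.tabulate (λ z∈ → λ { refl → y∉ z∈ }) ∷ up) (All.tabulate (λ {z} _ → ∈-allFin z)))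
                             (≤-trans (≤-reflexive length-allFin) le)))
    extendPath (suc m) p up lp s∈ le | no _ | _ | x , y , x∈ , y∉ , xy | first refl =
      extendPath m (y ∷ p) (All.tabulate (λ z∈ → λ { refl → y∉ z∈ }) ∷ up) (~-sym xy ∷ lp) (here refl)
        (≤-trans le (≤-reflexive (sym (+-suc m (length p)))))
    extendPath (suc m) p up lp s∈ le | no _ | _ | x , y , x∈ , y∉ , xy | last {xs} refl =
      extendPath m (p ∷ʳ y) (Unique-resp-↭ (∷↭∷ʳ y p) (All.tabulate (λ z∈ → λ { refl → y∉ z∈ }) ∷ up))
        (linked-snoc xs lp xy) (∈-++⁺ʳ p (here refl))
        (≤-trans le (≤-reflexive (trans (sym (+-suc m (length p))) (cong (m +_) (↭-length (∷↭∷ʳ y p))))))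

    traceable⊎3≤d : Traceable G ⊎ ∃ λ v → 3 ≤ d v
    traceable⊎3≤d = start (allFin (n G)) ∈-allFin
      where
      start : ∀ vs → (∀ v → v ∈ vs) → Traceable G ⊎ ∃ λ v → 3 ≤ d v
      start []      cover = inj₁ ([] , [] , cover , [])
      start (v ∷ _) _     = extendPath (n G) [ v ] ([] ∷ []) [-] (here refl) (m≤m+n _ _)

-- Connected triangle-free claw-heavy graphs

-- Write k = l + j; cancelling 2l leaves j + r ≤ 1. In the application, k and l are the degrees of
-- `v` and `x`, and r counts the vertices outside both neighbourhoods.
nearlyBalanced : ∀ {k l r} → k + (l + r) ≤ suc (l + l) → l ≤ k →
                 (r ≡ 0 × k ≡ suc l) ⊎ (r ≡ 0 × k ≡ l) ⊎ (r ≡ 1 × k ≡ l)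
nearlyBalanced {l = l} {r} le l≤k with m≤n⇒∃[o]m+o≡n l≤k
... | j , refl with +-cancelˡ-≤ (l + l) (j + r) 1 (≤-trans (≤-reflexive (regroup l j r)) (≤-trans le (≤-reflexive (+-comm 1 (l + l)))))
  where
  regroup : ∀ l j r → (l + l) + (j + r) ≡ l + j + (l + r)
  regroup = solve-∀
nearlyBalanced {l = l} {zero}        le l≤k | zero , refl | _     = inj₂ (inj₁ (refl , +-identityʳ l))
nearlyBalanced {l = l} {suc zero}    le l≤k | zero , refl | _     = inj₂ (inj₂ (refl , +-identityʳ l))
nearlyBalanced {l = l} {suc (suc _)} le l≤k | zero , refl | s≤s ()
nearlyBalanced {l = l} {zero}        le l≤k | suc zero , refl | _ = inj₁ (refl , +-comm l 1)
nearlyBalanced {l = l} {suc _}       le l≤k | suc zero , refl | s≤s ()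
nearlyBalanced {l = l} {_}           le l≤k | suc (suc _) , refl | s≤s ()

module Dense (G : Graph) (conn : Connected G) where

  open Neighbours G

  -- The successor on the right avoids truncated subtraction on the left.
  HeavyPair : V → V → Set
  HeavyPair a b = n G ≤ suc (d a + d b)

  module _ (triangle-free : ∀ {u v w} → u ~ v → v ~ w → u ~ w → ⊥)
           (claw-heavy : ∀ {v a b c} → v ~ a → v ~ b → v ~ c → a ≢ b → a ≢ c → b ≢ c →
                         HeavyPair a b ⊎ HeavyPair a c ⊎ HeavyPair b c) where

    twoOfThree : ∀ {P : V → Set} {v} → (∀ {a b} → v ~ a → v ~ b → HeavyPair a b → P a × P b) → TwoOfThree P (nbrs v)
    twoOfThree heavy⇒P a∈ b∈ c∈ a≢b a≢c b≢c with claw-heavy (nbrs-∈ a∈) (nbrs-∈ b∈) (nbrs-∈ c∈) a≢b a≢c b≢c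
    ... | inj₁ h        = inj₁ (heavy⇒P (nbrs-∈ a∈) (nbrs-∈ b∈) h)
    ... | inj₂ (inj₁ h) = inj₂ (inj₁ (heavy⇒P (nbrs-∈ a∈) (nbrs-∈ c∈) h))
    ... | inj₂ (inj₂ h) = inj₂ (inj₂ (heavy⇒P (nbrs-∈ b∈) (nbrs-∈ c∈) h))

    nbrs-++-unique : ∀ {u v} → u ~ v → Unique (nbrs u ++ nbrs v)
    nbrs-++-unique {u} {v} uv = Uniq.++⁺ (nbrs-unique u) (nbrs-unique v)
      λ (w∈u , w∈v) → triangle-free uv (nbrs-∈ w∈v) (nbrs-∈ w∈u)

    -- As `allFin` lists every vertex once, the permutation says both that N(v), N(x) and `R` are
    -- disjoint and that they cover V.
    Split : V → V → List V → Set
    Split v x R = allFin (n G) ↭ nbrs v ++ nbrs x ++ R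

    split-swap : ∀ {v x R} → Split v x R → Split x v R
    split-swap {v} {x} s = ↭-trans s (shifts (nbrs v) (nbrs x))

    size : ∀ {v x R} → Split v x R → n G ≡ d v + (d x + length R)
    size {v} {x} s = trans (sym length-allFin) (trans (↭-length s)
      (trans (length-++ (nbrs v)) (cong (d v +_) (length-++ (nbrs x)))))

    cover : ∀ {v x R} → Split v x R → ∀ u → v ~ u ⊎ x ~ u ⊎ u ∈ R
    cover {v} {x} s u with ∈-++⁻ (nbrs v) (∈-resp-↭ s (∈-allFin u))
    ... | inj₁ u∈ = inj₁ (nbrs-∈ u∈)
    ... | inj₂ u∈ with ∈-++⁻ (nbrs x) u∈
    ... | inj₁ u∈x = inj₂ (inj₁ (nbrs-∈ u∈x))
    ... | inj₂ u∈R = inj₂ (inj₂ u∈R)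

    -- By triangle-freeness N(a) avoids N(v), and it avoids `R`, so it lies in N(x); the degree
    -- bound makes this inclusion an equality.
    saturated : ∀ {v x R a} → Split v x R → v ~ a → (∀ {u} → u ∈ R → ¬ a ~ u) → d x ≤ d a → ∀ {b} → x ~ b → a ~ b
    saturated {v} {x} {R} {a} s va noR le xb = nbrs-∈ (∈-resp-↭ (⊆⇒↭ (nbrs-unique a) (All.tabulate ⊆x) le) (∈-nbrs xb))
      where
      ⊆x : ∀ {u} → u ∈ nbrs a → u ∈ nbrs x
      ⊆x {u} u∈ with cover s u
      ... | inj₁ vu        = ⊥-elim (triangle-free va (nbrs-∈ u∈) vu)
      ... | inj₂ (inj₁ xu) = ∈-nbrs xu
      ... | inj₂ (inj₂ uR) = ⊥-elim (noR uR (nbrs-∈ u∈))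

    d≤ : ∀ {v x a} → Split v x [] → v ~ a → d a ≤ d x
    d≤ {v} {x} {a} s va = length-⊆ (nbrs-unique a) (All.tabulate ⊆x)
      where
      ⊆x : ∀ {u} → u ∈ nbrs a → u ∈ nbrs x
      ⊆x {u} u∈ with cover s u
      ... | inj₁ vu        = ⊥-elim (triangle-free va (nbrs-∈ u∈) vu)
      ... | inj₂ (inj₁ xu) = ∈-nbrs xu

    -- The vertices a with d x ≤ d a are joined to all of N(x); z is the exceptional one.
    unbalanced : ∀ {v x} → v ~ x → Split v x [] → d v ≡ suc (d x) → 3 ≤ d v → Traceable G
    unbalanced {v} {x} vx s dv≡ 3≤dv
      with allButOne (λ a → d x ≤? d a) (nbrs-unique v) (≤-trans (s≤s z≤n) 3≤dv)
             (notBoth (nbrs-unique v) 3≤dv (twoOfThree heavy⇒full)) | ∈⇒↭ (∈-nbrs (~-sym vx))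
      where
      -- Here n = 2d(x) + 1, so a heavy pair has degree sum at least 2d(x), while neither degree
      -- exceeds d(x).
      heavy⇒full : ∀ {a b} → v ~ a → v ~ b → HeavyPair a b → d x ≤ d a × d x ≤ d b
      heavy⇒full {a} {b} va vb h = m+m≤a+b∧b≤m⇒m≤a le (d≤ s vb) , m+m≤a+b∧b≤m⇒m≤a (≤-trans le (≤-reflexive (+-comm (d a) (d b)))) (d≤ s va)
        where
        le : d x + d x ≤ d a + d b
        le = ≤-pred (≤-trans (≤-reflexive (sym (trans (size s) (cong₂ _+_ dv≡ (+-identityʳ (d x)))))) h)
    ... | z , [] , p , _ | _ = ⊥-elim (n≮0 (≤-pred (≤-trans 3≤dv (≤-reflexive (↭-length p)))))
    -- The path is `z`, `v`, then `as` alternating with `bs`, then `a₁`.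
    ... | z , a₁ ∷ as , p , full | bs , q =
      ↭⇒traceable (~-sym (A∋ (here refl)) ∷ linked) (↭-trans s (↭-trans (++⁺ p (++⁺ʳ [] q)) shuffle))
      where
      A∋ : ∀ {a} → a ∈ z ∷ a₁ ∷ as → v ~ a
      A∋ = nbrs-∈ ∘ ∈-resp-↭ (↭-sym p)

      joined : ∀ {a b} → a ∈ a₁ ∷ as → b ∈ v ∷ bs → a ~ b
      joined a∈ b∈ = saturated s (A∋ (there a∈)) (λ ()) (All.lookup full a∈) (nbrs-∈ (∈-resp-↭ (↭-sym q) b∈))

      linked : Linked _~_ (v ∷ alternate as bs ++ [ a₁ ])
      linked = alternate-linked ~-sym as bs (joined ∘ there) (λ b∈ → ~-sym (joined (here refl) b∈) ∷ [-])

      open PermSolver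
      shuffle : (z ∷ a₁ ∷ as) ++ (v ∷ bs) ++ [] ↭ z ∷ v ∷ alternate as bs ++ [ a₁ ]
      shuffle = ↭-trans
        (solve 5 (λ z a as v bs → (z ⊕ (a ⊕ as)) ⊕ ((v ⊕ bs) ⊕ id′) ⊜ z ⊕ (v ⊕ ((as ⊕ bs) ⊕ a))) ↭-refl [ z ] [ a₁ ] as [ v ] bs)
        (prep z (prep v (++⁺ʳ [ a₁ ] (↭-sym (alternate-↭ as bs
          (suc-injective (suc-injective (trans (sym (↭-length p)) (trans dv≡ (cong suc (↭-length q)))))))))))
        where id′ = PermSolver.id

    -- As a₃ ∷ as is joined to all of N(x) and a₂ has a neighbour b₁ ≠ v in N(x), a₁ v a₂ b₁ a₃ … is a path.
    balanced′ : ∀ {v x} → v ~ x → Split v x [] → d v ≡ d x → ∀ {a₁ a₂ a₃ as} → nbrs v ↭ a₁ ∷ a₂ ∷ a₃ ∷ as →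
                All (λ a → d x ≤ d a) (a₃ ∷ as) → d x ≤ suc (d a₂) → Traceable G
    balanced′ {v} {x} vx s dv≡ {a₁} {a₂} {a₃} {as} p full le with ∈⇒↭ (∈-nbrs (~-sym (nbrs-∈ {v} (∈-resp-↭ (↭-sym p) (there (here refl))))))
    -- If `v` were the only neighbour of `a₂`, then d(v) = d(x) ≤ 2, but `v` has three neighbours.
    ... | [] , r = ⊥-elim (n≮0 (≤-pred (≤-pred (≤-trans (≤-trans (≤-reflexive (trans (sym (↭-length p)) dv≡)) le) (s≤s (≤-reflexive (↭-length r)))))))
    ... | b₁ ∷ _ , r
      with complement (((v≢b₁ (Unique-resp-↭ r (nbrs-unique a₂))) ∷ []) ∷ [] ∷ []) (∈-nbrs (~-sym vx) ∷ b₁∈ ∷ [])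
      where
      v≢b₁ : ∀ {bs} → Unique (v ∷ b₁ ∷ bs) → v ≢ b₁
      v≢b₁ ((v≢b₁ ∷ _) ∷ _) = v≢b₁
      b₁∈ : b₁ ∈ nbrs x
      b₁∈ with cover s b₁
      ... | inj₁ vb₁ = ⊥-elim (triangle-free (nbrs-∈ (∈-resp-↭ (↭-sym p) (there (here refl))))
                                             (nbrs-∈ (∈-resp-↭ (↭-sym r) (there (here refl)))) vb₁)
      ... | inj₂ (inj₁ xb₁) = ∈-nbrs xb₁
    ... | bs , q =
      ↭⇒traceable (~-sym (A∋ (here refl)) ∷ A∋ (there (here refl)) ∷ nbrs-∈ (∈-resp-↭ (↭-sym r) (there (here refl))) ∷ linked)
                  (↭-trans s (↭-trans (++⁺ p (++⁺ʳ [] q)) shuffle))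
      where
      A∋ : ∀ {a} → a ∈ a₁ ∷ a₂ ∷ a₃ ∷ as → v ~ a
      A∋ = nbrs-∈ ∘ ∈-resp-↭ (↭-sym p)

      joined : ∀ {a b} → a ∈ a₃ ∷ as → b ∈ v ∷ b₁ ∷ bs → a ~ b
      joined a∈ b∈ = saturated s (A∋ (there (there a∈))) (λ ()) (All.lookup full a∈) (nbrs-∈ (∈-resp-↭ (↭-sym q) b∈))

      linked : Linked _~_ (b₁ ∷ alternate (a₃ ∷ as) bs ++ [])
      linked = alternate-linked ~-sym (a₃ ∷ as) bs (λ a∈ b∈ → joined a∈ (there b∈)) (λ _ → [-])

      open PermSolver
      shuffle : (a₁ ∷ a₂ ∷ a₃ ∷ as) ++ (v ∷ b₁ ∷ bs) ++ [] ↭ a₁ ∷ v ∷ a₂ ∷ b₁ ∷ alternate (a₃ ∷ as) bs ++ []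
      shuffle = ↭-trans
        (solve 6 (λ a₁ a₂ as v b₁ bs → (a₁ ⊕ (a₂ ⊕ as)) ⊕ ((v ⊕ (b₁ ⊕ bs)) ⊕ id′) ⊜ a₁ ⊕ (v ⊕ (a₂ ⊕ (b₁ ⊕ ((as ⊕ bs) ⊕ id′)))))
          ↭-refl [ a₁ ] [ a₂ ] (a₃ ∷ as) [ v ] [ b₁ ] bs)
        (prep a₁ (prep v (prep a₂ (prep b₁ (++⁺ʳ [] (↭-sym (alternate-↭ (a₃ ∷ as) bs
          (suc-injective (suc-injective (trans (sym (↭-length p)) (trans dv≡ (↭-length q))))))))))))
        where id′ = PermSolver.id

    -- Now n = 2d(x), so two vertices of degree below d(x) are never a heavy pair, and at most two
    -- neighbours of `v` have such a degree. The heavy pair among `a₁`, `a₂`, `a₃` contains `a₁` or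
    -- `a₂`; that vertex has degree at least d(x) - 1 and, after a swap if necessary, becomes the
    -- second.
    balanced : ∀ {v x} → v ~ x → Split v x [] → d v ≡ d x → 3 ≤ d v → Traceable G
    balanced {v} {x} vx s dv≡ 3≤dv
      with allButTwo (λ a → d x ≤? d a) (nbrs-unique v) (<⇒≤ 3≤dv) noThree
      where
      light : ∀ {a b} → HeavyPair a b → ¬ d x ≤ d a → ¬ d x ≤ d b → ⊥
      light {a} {b} h a< b< = 1+n≰n (≤-trans (s≤s (≤-reflexive (sym (+-suc (d a) (d b)))))
        (≤-trans (+-mono-≤ (≰⇒> a<) (≰⇒> b<)) (≤-trans (≤-reflexive (sym (trans (size s) (cong₂ _+_ dv≡ (+-identityʳ (d x)))))) h)))

      noThree : ∀ {a b c} → a ∈ nbrs v → b ∈ nbrs v → c ∈ nbrs v → a ≢ b → a ≢ c → b ≢ c →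
                ¬ d x ≤ d a → ¬ d x ≤ d b → ¬ d x ≤ d c → ⊥
      noThree a∈ b∈ c∈ a≢b a≢c b≢c a< b< c< with claw-heavy (nbrs-∈ a∈) (nbrs-∈ b∈) (nbrs-∈ c∈) a≢b a≢c b≢c
      ... | inj₁ h        = light h a< b<
      ... | inj₂ (inj₁ h) = light h a< c<
      ... | inj₂ (inj₂ h) = light h b< c<
    ... | a₁ , a₂ , [] , p , _ = ⊥-elim (1+n≰n (≤-trans 3≤dv (≤-reflexive (↭-length p))))
    ... | a₁ , a₂ , a₃ ∷ as , p , full = finish (Unique-resp-↭ p (nbrs-unique v))
      where
      A∋ : ∀ {a} → a ∈ a₁ ∷ a₂ ∷ a₃ ∷ as → v ~ a
      A∋ = nbrs-∈ ∘ ∈-resp-↭ (↭-sym p)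

      almostFull : ∀ {a b} → v ~ a → v ~ b → HeavyPair a b → d x ≤ suc (d a)
      almostFull {a} {b} va vb h = m+m≤a+b∧b≤m⇒m≤a (≤-trans (≤-reflexive (sym (trans (size s) (cong₂ _+_ dv≡ (+-identityʳ (d x)))))) h) (d≤ s vb)

      finish : Unique (a₁ ∷ a₂ ∷ a₃ ∷ as) → Traceable G
      finish ((a₁≢a₂ ∷ a₁≢a₃ ∷ _) ∷ (a₂≢a₃ ∷ _) ∷ _)
        with claw-heavy (A∋ (here refl)) (A∋ (there (here refl))) (A∋ (there (there (here refl)))) a₁≢a₂ a₁≢a₃ a₂≢a₃
      ... | inj₁ h        = balanced′ vx s dv≡ (↭-trans p (swap a₁ a₂ ↭-refl)) full (almostFull (A∋ (here refl)) (A∋ (there (here refl))) h)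
      ... | inj₂ (inj₁ h) = balanced′ vx s dv≡ (↭-trans p (swap a₁ a₂ ↭-refl)) full (almostFull (A∋ (here refl)) (A∋ (there (there (here refl)))) h)
      ... | inj₂ (inj₂ h) = balanced′ vx s dv≡ p full (almostFull (A∋ (there (here refl))) (A∋ (there (there (here refl)))) h)

    -- One vertex outside both neighbourhoods

    module Surplus (k : ℕ) (d≤k : ∀ u → d u ≤ k) (3≤k : 3 ≤ k) where

      -- A frame forces n = 2k + 1 and is symmetric in `v` and `x`: results on N(v) pass to N(x)
      -- through `mirror`.
      record Frame (v x w : V) : Set where
        field
          vx    : v ~ x
          dv    : d v ≡ k
          dx    : d x ≡ k
          split : Split v x [ w ]

      open Frame

      mirror : ∀ {v x w} → Frame v x w → Frame x v w
      mirror f = record { vx = ~-sym (vx f) ; dv = dx f ; dx = dv f ; split = split-swap (split f) }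

      w∉v : ∀ {v x w} → Frame v x w → ¬ v ~ w
      w∉v {v} {x} {w} f vw = Uniq.Unique[x∷xs]⇒x∉xs
        (Unique-resp-↭ (↭-trans (split f) (shuffle (nbrs v) (nbrs x))) (Uniq.allFin⁺ (n G))) (∈-++⁺ˡ (∈-nbrs vw))
        where
        shuffle : ∀ as bs → as ++ bs ++ [ w ] ↭ w ∷ as ++ bs
        shuffle as bs = solve 3 (λ as bs w → as ⊕ (bs ⊕ w) ⊜ w ⊕ (as ⊕ bs)) ↭-refl as bs [ w ]
          where open PermSolver

      -- As n = 2k + 1, a heavy pair has degree sum at least 2k, so both its members have degree k.
      notBothLow : ∀ {v x w} → Frame v x w → ∀ {a b} → a ∈ nbrs v → b ∈ nbrs v → a ≢ b → ¬ k ≤ d a → ¬ k ≤ d b → ⊥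
      notBothLow {v} {x} f = notBoth (nbrs-unique v) (≤-trans 3≤k (≤-reflexive (sym (dv f)))) (twoOfThree λ {a} {b} _ _ h →
        m+m≤a+b∧b≤m⇒m≤a (le h) (d≤k b) , m+m≤a+b∧b≤m⇒m≤a (≤-trans (le h) (≤-reflexive (+-comm (d a) (d b)))) (d≤k a))
        where
        le : ∀ {a b} → HeavyPair a b → k + k ≤ d a + d b
        le h = ≤-pred (≤-trans (≤-reflexive (sym (trans (size (split f))
          (trans (cong₂ (λ y z → y + (z + 1)) (dv f) (dx f)) (trans (cong (k +_) (+-comm k 1)) (+-suc k k)))))) h)

      joinedAll : ∀ {v x w a} → Frame v x w → v ~ a → ¬ w ~ a → k ≤ d a → ∀ {b} → x ~ b → a ~ b
      joinedAll f va wa le = saturated (split f) va (λ { (here refl) aw → wa (~-sym aw) }) (≤-trans (≤-reflexive (dx f)) le)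

      private
        2+≡ : ∀ {v x w} → Frame v x w → ∀ {a b xs} → nbrs v ↭ a ∷ b ∷ xs → ∀ {c e ys} → nbrs x ↭ c ∷ e ∷ ys → length xs ≡ length ys
        2+≡ f p q = suc-injective (suc-injective (trans (sym (↭-length p)) (trans (dv f) (trans (sym (dx f)) (↭-length q)))))

        3≰2 : ∀ {v xs} → d v ≡ k → nbrs v ↭ xs → ¬ length xs ≤ 2
        3≰2 dv p le = 1+n≰n (≤-trans 3≤k (≤-trans (≤-reflexive (trans (sym dv) (↭-length p))) le))

      -- The path is w a₁ b₁ … x b₀, where b₀ is the vertex of N(x) that may have small degree.
      oneSided : ∀ {v x w} → Frame v x w → (∀ {b} → x ~ b → ¬ w ~ b) → Traceable G
      oneSided {v} {x} {w} f noB
        -- Connectedness gives `w` a neighbour `a₁`, which must lie in N(v).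
        with boundary G (_≟ w) (conn w v) refl (λ { refl → w∉v (mirror f) (~-sym (vx f)) })
           | allButOne (λ b → k ≤? d b) (nbrs-unique x) (≤-trans (s≤s z≤n) (≤-trans 3≤k (≤-reflexive (sym (dx f))))) (notBothLow (mirror f))
      ... | .w , a₁ , refl , a₁≢w , wa₁ | b₀ , [] , q , _ = ⊥-elim (3≰2 (dx f) q (s≤s z≤n))
      ... | .w , a₁ , refl , a₁≢w , wa₁ | b₀ , b₁ ∷ bs , q , full
        with complement (((λ { refl → w∉v (mirror f) (~-sym wa₁) }) ∷ []) ∷ [] ∷ []) (va₁ ∷ ∈-nbrs (vx f) ∷ [])
        where
        va₁ : a₁ ∈ nbrs v
        va₁ with cover (split f) a₁
        ... | inj₁ va₁               = ∈-nbrs va₁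
        ... | inj₂ (inj₁ xa₁)        = ⊥-elim (noB xa₁ wa₁)
        ... | inj₂ (inj₂ (here a₁≡)) = ⊥-elim (a₁≢w a₁≡)
      ... | as , p = ↭⇒traceable (wa₁ ∷ ~-sym (joined (here refl) (here refl)) ∷ linked)
                                 (↭-trans (split f) (↭-trans (++⁺ p (++⁺ʳ [ w ] q)) shuffle))
        where
        joined : ∀ {a b} → b ∈ b₁ ∷ bs → a ∈ a₁ ∷ x ∷ as → b ~ a
        joined b∈ a∈ = joinedAll (mirror f) (B∋ b∈) (noB (B∋ b∈)) (All.lookup full b∈) (nbrs-∈ (∈-resp-↭ (↭-sym p) a∈))
          where B∋ : ∀ {b} → b ∈ b₁ ∷ bs → x ~ b
                B∋ = nbrs-∈ ∘ ∈-resp-↭ (↭-sym q) ∘ there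

        linked : Linked _~_ (b₁ ∷ alternate as bs ++ x ∷ b₀ ∷ [])
        linked = alternate-linked ~-sym as bs (λ a∈ b∈ → ~-sym (joined b∈ (there (there a∈))))
          (λ b∈ → joined b∈ (there (here refl)) ∷ nbrs-∈ (∈-resp-↭ (↭-sym q) (here refl)) ∷ [-])

        open PermSolver
        shuffle : (a₁ ∷ x ∷ as) ++ (b₀ ∷ b₁ ∷ bs) ++ [ w ] ↭ w ∷ a₁ ∷ b₁ ∷ alternate as bs ++ x ∷ b₀ ∷ []
        shuffle = ↭-trans
          (solve 7 (λ w a₁ x as b₀ b₁ bs → (a₁ ⊕ (x ⊕ as)) ⊕ ((b₀ ⊕ (b₁ ⊕ bs)) ⊕ w) ⊜ w ⊕ (a₁ ⊕ (b₁ ⊕ ((as ⊕ bs) ⊕ (x ⊕ b₀)))))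
            ↭-refl [ w ] [ a₁ ] [ x ] as [ b₀ ] [ b₁ ] bs)
          (prep w (prep a₁ (prep b₁ (++⁺ʳ (x ∷ b₀ ∷ []) (↭-sym (alternate-↭ as bs (2+≡ f p q)))))))

      -- The path is b₀ x … b w a v a₀; the vertices of degree k in N(v) ∖ {a} miss w, hence nothing else.
      bridged : ∀ {v x w a b} → Frame v x w → v ~ a → w ~ a → x ~ b → w ~ b →
                (∀ {a′} → v ~ a′ → w ~ a′ → a′ ≡ a) → Traceable G
      bridged {v} {x} {w} {a} {b} f va wa xb wb only
        with complement (((λ { refl → w∉v (mirror f) (~-sym wa) }) ∷ []) ∷ [] ∷ []) (∈-nbrs va ∷ ∈-nbrs (vx f) ∷ [])
           | complement (((λ { refl → w∉v f (~-sym wb) }) ∷ []) ∷ [] ∷ []) (∈-nbrs xb ∷ ∈-nbrs (~-sym (vx f)) ∷ [])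
      ... | [] , p | _ = ⊥-elim (3≰2 (dv f) p ≤-refl)
      ... | _ | [] , q = ⊥-elim (3≰2 (dx f) q ≤-refl)
      ... | rest@(_ ∷ _) , p | b₀ ∷ bs , q with Unique-resp-↭ p (nbrs-unique v)
      ... | (_ ∷ a≢rest) ∷ _ ∷ urest
        with allButOne (λ a → k ≤? d a) urest (s≤s z≤n)
               (λ a∈ b∈ → notBothLow f (∈-resp-↭ (↭-sym p) (there (there a∈))) (∈-resp-↭ (↭-sym p) (there (there b∈))))
      ... | a₀ , as , r , full =
        ↭⇒traceable (~-sym (B∋ (there (there (here refl)))) ∷ linked)
                    (↭-trans (split f) (↭-trans (++⁺ p′ (++⁺ʳ [ w ] q)) shuffle))
        where
        p′ : nbrs v ↭ a ∷ x ∷ a₀ ∷ as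
        p′ = ↭-trans p (prep a (prep x r))

        A∋ : ∀ {a′} → a′ ∈ a ∷ x ∷ a₀ ∷ as → v ~ a′
        A∋ = nbrs-∈ ∘ ∈-resp-↭ (↭-sym p′)

        B∋ : ∀ {b′} → b′ ∈ b ∷ v ∷ b₀ ∷ bs → x ~ b′
        B∋ = nbrs-∈ ∘ ∈-resp-↭ (↭-sym q)

        joined : ∀ {a′ b′} → a′ ∈ x ∷ as → b′ ∈ b ∷ v ∷ b₀ ∷ bs → a′ ~ b′
        -- `x` is adjacent to N(x) trivially; the vertices of `as` miss `w`, whose only neighbour in
        -- N(v) is `a`.
        joined (here refl) b∈ = B∋ b∈
        joined (there a∈)  b∈ = joinedAll f va′ (λ wa′ → All.lookup a≢rest (∈-resp-↭ (↭-sym r) (there a∈)) (sym (only va′ wa′)))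
                                  (All.lookup full a∈) (B∋ b∈)
          where va′ = A∋ (there (there (there a∈)))

        linked : Linked _~_ (x ∷ alternate bs as ++ b ∷ w ∷ a ∷ v ∷ a₀ ∷ [])
        linked = alternate-linked ~-sym bs as (λ b∈ a∈ → ~-sym (joined a∈ (there (there (there b∈)))))
          (λ a∈ → joined a∈ (here refl) ∷ ~-sym wb ∷ wa ∷ ~-sym va ∷ A∋ (there (there (here refl))) ∷ [-])

        open PermSolver
        shuffle : (a ∷ x ∷ a₀ ∷ as) ++ (b ∷ v ∷ b₀ ∷ bs) ++ [ w ] ↭ b₀ ∷ x ∷ alternate bs as ++ b ∷ w ∷ a ∷ v ∷ a₀ ∷ []
        shuffle = ↭-trans
          (solve 9 (λ a x a₀ as b v b₀ bs w → (a ⊕ (x ⊕ (a₀ ⊕ as))) ⊕ ((b ⊕ (v ⊕ (b₀ ⊕ bs))) ⊕ w) ⊜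
                                              b₀ ⊕ (x ⊕ ((bs ⊕ as) ⊕ (b ⊕ (w ⊕ (a ⊕ (v ⊕ a₀)))))))
            ↭-refl [ a ] [ x ] [ a₀ ] as [ b ] [ v ] [ b₀ ] bs [ w ])
          (prep b₀ (prep x (++⁺ʳ (b ∷ w ∷ a ∷ v ∷ a₀ ∷ []) (↭-sym (alternate-↭ bs as (sym (suc-injective (2+≡ f p′ q))))))))

      -- Being adjacent to `w`, the vertex `a` misses `b` and `b′`. So N(a) lies in N(x) with these
      -- two removed and `w` added, which has k - 1 elements.
      low : ∀ {v x w a b b′} → Frame v x w → v ~ a → w ~ a → x ~ b → w ~ b → x ~ b′ → w ~ b′ → b ≢ b′ → ¬ k ≤ d a
      low {v} {x} {w} {a} {b} {b′} f va wa xb wb xb′ wb′ b≢b′ k≤ =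
        1+n≰n (≤-trans (s≤s (s≤s k≤)) (≤-trans (length-⊆ unique (∈-wx xb ∷ ∈-wx xb′ ∷ All.tabulate (⊆wx ∘ nbrs-∈))) (s≤s (≤-reflexive (dx f)))))
        where
        ∈-wx : ∀ {u} → x ~ u → u ∈ w ∷ nbrs x
        ∈-wx xu = there (∈-nbrs xu)

        ⊆wx : ∀ {u} → a ~ u → u ∈ w ∷ nbrs x
        ⊆wx {u} au with cover (split f) u
        ... | inj₁ vu               = ⊥-elim (triangle-free va au vu)
        ... | inj₂ (inj₁ xu)        = ∈-wx xu
        ... | inj₂ (inj₂ (here u≡)) = here u≡

        unique : Unique (b ∷ b′ ∷ nbrs a)
        unique = (b≢b′ ∷ All.tabulate (λ { b∈ refl → triangle-free wa (nbrs-∈ b∈) wb })) ∷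
                 All.tabulate (λ { b∈ refl → triangle-free wa (nbrs-∈ b∈) wb′ }) ∷ nbrs-unique a

      -- The cases count the neighbours of `w` in N(v) and N(x): none on one side, exactly one on
      -- one side, or two on each. In the last case two vertices of N(v) are `low`, which
      -- `notBothLow` forbids.
      surplus : ∀ {v x w} → Frame v x w → Traceable G
      surplus {v} {x} {w} f with any? (λ a → v ~? a ×-dec w ~? a) | any? (λ b → x ~? b ×-dec w ~? b)
      ... | no none | _ = oneSided (mirror f) (λ va wa → none (_ , va , wa))
      ... | _ | no none = oneSided f (λ xb wb → none (_ , xb , wb))
      ... | yes (a , va , wa) | yes (b , xb , wb)
        with any? (λ a′ → v ~? a′ ×-dec w ~? a′ ×-dec ¬? (a′ ≟ a)) | any? (λ b′ → x ~? b′ ×-dec w ~? b′ ×-dec ¬? (b′ ≟ b))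
      ... | no none | _ = bridged f va wa xb wb (λ {a′} va′ wa′ → only a′ va′ wa′)
        where only : ∀ a′ → v ~ a′ → w ~ a′ → a′ ≡ a
              only a′ va′ wa′ with a′ ≟ a
              ... | yes eq = eq
              ... | no neq′ = ⊥-elim (none (a′ , va′ , wa′ , neq′))
      ... | _ | no none = bridged (mirror f) xb wb va wa (λ {b′} xb′ wb′ → only b′ xb′ wb′)
        where only : ∀ b′ → x ~ b′ → w ~ b′ → b′ ≡ b
              only b′ xb′ wb′ with b′ ≟ b
              ... | yes eq = eq
              ... | no neq′ = ⊥-elim (none (b′ , xb′ , wb′ , neq′))
      ... | yes (a′ , va′ , wa′ , a′≢a) | yes (b′ , xb′ , wb′ , b′≢b) =
        ⊥-elim (notBothLow f (∈-nbrs va) (∈-nbrs va′) (a′≢a ∘ sym)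
          (low f va wa xb wb xb′ wb′ (b′≢b ∘ sym)) (low f va′ wa′ xb wb xb′ wb′ (b′≢b ∘ sym)))

    maxDegree : ∀ u → ∃ λ v → d u ≤ d v × (∀ w → d w ≤ d v)
    maxDegree u = argmax d u (allFin (n G)) , All.lookup le (∈-allFin u) , λ w → All.lookup le (∈-allFin w)
      where le = f[xs]≤f[argmax] {f = d} u (allFin (n G))

    -- Heaviness gives n ≤ 1 + d(x) + d(y) ≤ 1 + 2d(x), while n = d(v) + d(x) + |R|;
    -- `nearlyBalanced` then leaves three cases.
    dense : ∀ {v x y} → v ~ x → v ~ y → HeavyPair x y → d y ≤ d x → (∀ u → d u ≤ d v) → 3 ≤ d v → Traceable G
    dense {v} {x} {y} vx vy h y≤x max 3≤dv
      with complement (nbrs-++-unique vx) (All.tabulate (λ {u} _ → ∈-allFin u))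
    ... | R , s₀ = finish R s (nearlyBalanced (≤-trans (≤-reflexive (sym (size s))) (≤-trans h (s≤s (+-monoʳ-≤ (d x) y≤x)))) (max x))
      where
      s : Split v x R
      s = ↭-trans s₀ (↭-reflexive (++-assoc (nbrs v) (nbrs x) R))

      finish : ∀ R → Split v x R → (length R ≡ 0 × d v ≡ suc (d x)) ⊎ (length R ≡ 0 × d v ≡ d x) ⊎ (length R ≡ 1 × d v ≡ d x) → Traceable G
      finish []      s (inj₁ (_ , eq))        = unbalanced vx s eq 3≤dv
      finish []      s (inj₂ (inj₁ (_ , eq))) = balanced vx s eq 3≤dv
      finish (w ∷ []) s (inj₂ (inj₂ (_ , eq))) =
        Surplus.surplus (d v) max 3≤dv (record { vx = vx ; dv = refl ; dx = sym eq ; split = s })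

    traceable : Traceable G
    traceable with traceable⊎3≤d conn
    ... | inj₁ t = t
    ... | inj₂ (u , 3≤du) with maxDegree u
    ... | v , u≤v , max = claw (nbrs v) refl
      where
      3≤dv = ≤-trans 3≤du u≤v

      oriented : ∀ {a b} → v ~ a → v ~ b → HeavyPair a b → Traceable G
      oriented {a} {b} va vb h with ≤-total (d b) (d a)
      ... | inj₁ b≤a = dense va vb h b≤a max 3≤dv
      ... | inj₂ a≤b = dense vb va (≤-trans h (s≤s (≤-reflexive (+-comm (d a) (d b))))) a≤b max 3≤dv

      claw : ∀ xs → nbrs v ≡ xs → Traceable G
      claw [] eq = ⊥-elim (n≮0 (subst (3 ≤_) (cong length eq) 3≤dv))
      claw (_ ∷ []) eq = ⊥-elim (n≮0 (≤-pred (subst (3 ≤_) (cong length eq) 3≤dv)))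
      claw (_ ∷ _ ∷ []) eq = ⊥-elim (1+n≰n (subst (3 ≤_) (cong length eq) 3≤dv))
      claw (a ∷ b ∷ c ∷ _) eq with subst Unique eq (nbrs-unique v)
      ... | (a≢b ∷ a≢c ∷ _) ∷ (b≢c ∷ _) ∷ _ = pick (claw-heavy va vb vc a≢b a≢c b≢c)
        where
        va = nbrs-∈ (subst (a ∈_) (sym eq) (here refl))
        vb = nbrs-∈ (subst (b ∈_) (sym eq) (there (here refl)))
        vc = nbrs-∈ (subst (c ∈_) (sym eq) (there (there (here refl))))

        pick : HeavyPair a b ⊎ HeavyPair a c ⊎ HeavyPair b c → Traceable G
        pick (inj₁ h)        = oriented va vb h
        pick (inj₂ (inj₁ h)) = oriented va vc h
        pick (inj₂ (inj₂ h)) = oriented vb vc h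

-- Induced copies

copy-∘ : ∀ H K G → InducedCopy H K → InducedCopy K G → InducedCopy H G
copy-∘ H K G (f , f-inj , f-adj) (g , g-inj , g-adj) =
  g ∘ f , (λ x y → f-inj x y ∘ g-inj _ _) , λ u v → trans (g-adj _ _) (f-adj u v)

iso⇒copy : ∀ H G → Iso H G → InducedCopy H G
iso⇒copy H G (f , g , gf , _ , adj≡) = f , (λ x y e → trans (sym (gf x)) (trans (cong g e) (gf y))) , adj≡

iso-sym : ∀ H G → Iso H G → Iso G H
iso-sym H G (f , g , gf , fg , adj≡) =
  g , f , fg , gf , λ u v → trans (sym (adj≡ (g u) (g v))) (cong₂ (adj G) (fg u) (fg v))

-- An injection between vertex sets of equal size is onto; the inverse reads preimages off the list
-- of images.
copy⇒iso : ∀ H G → InducedCopy H G → n H ≡ n G → Iso H G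
copy⇒iso H G (f , f-inj , adj≡) nH≡nG =
  f , g , (λ x → f-inj _ _ (f∘g (f x))) , f∘g , adj≡
  where
  image : List (Fin (n G))
  image = map f (allFin (n H))

  onto : allFin (n G) ↭ image
  onto = ⊆⇒↭ (Uniq.map⁺ (f-inj _ _) (Uniq.allFin⁺ (n H))) (All.tabulate (λ {y} _ → ∈-allFin y))
    (≤-reflexive (trans (length-tabulate id) (trans (sym nH≡nG) (sym (trans (length-map f (allFin (n H))) (length-tabulate id))))))

  preimage : ∀ y → ∃ λ x → x ∈ allFin (n H) × y ≡ f x
  preimage y = ∈-map⁻ f (∈-resp-↭ onto (∈-allFin y))

  g : Fin (n G) → Fin (n H)
  g y = proj₁ (preimage y)

  f∘g : ∀ y → f (g y) ≡ y
  f∘g y = sym (proj₂ (proj₂ (preimage y)))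

heavy-resp-iso : ∀ H K G → Iso H K → Heavy H G → Heavy K G
heavy-resp-iso H K G i heavy c with heavy (copy-∘ H K G (iso⇒copy H K i) c)
... | u , v , u≢v , h = proj₁ i u , proj₁ i v , (λ e → u≢v (proj₁ (proj₂ (iso⇒copy H K i)) u v e)) , h

-- Maps between finite sets are coded by numbers and searched exhaustively. A decoded map agrees
-- with `f` only pointwise, hence the transports in `encode`.
copy? : ∀ H G → Dec (InducedCopy H G)
copy? H G = map′ (λ (k , p) → finToFun k , p) encode (any? (λ k → isCopy? (finToFun k)))
  where
  IsCopy : (Fin (n H) → Fin (n G)) → Set
  IsCopy f = (∀ x y → f x ≡ f y → x ≡ y) × (∀ u v → adj G (f u) (f v) ≡ adj H u v)

  isCopy? : ∀ f → Dec (IsCopy f)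
  isCopy? f = all? (λ x → all? λ y → (f x ≟ f y) →-dec (x ≟ y)) ×-dec
              all? (λ u → all? λ v → adj G (f u) (f v) Bool.≟ adj H u v)

  encode : InducedCopy H G → ∃ λ k → IsCopy (finToFun k)
  encode (f , f-inj , adj≡) = funToFin f ,
    (λ x y e → f-inj x y (trans (sym (finToFun-funToFin f x)) (trans e (finToFun-funToFin f y)))) ,
    (λ u v → trans (cong₂ (adj G) (finToFun-funToFin f u) (finToFun-funToFin f v)) (adj≡ u v))

neq-≢ : ∀ {m} {i j : Fin m} → i ≢ j → neq i j ≡ true
neq-≢ {i = i} {j} i≢j with i ≟ j
... | yes i≡j = ⊥-elim (i≢j i≡j)
... | no _    = refl

module _ (G : Graph) where

  open Neighbours G

  completeCopy : ∀ {m} (f : Fin m → V) → (∀ {i j} → i ≢ j → f i ~ f j) → InducedCopy (complete m) G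
  completeCopy f edge = f , f-inj , adj≡
    where
    f-inj : ∀ i j → f i ≡ f j → i ≡ j
    f-inj i j e with i ≟ j
    ... | yes i≡j = i≡j
    ... | no i≢j = ⊥-elim (~⇒≢ (edge i≢j) e)

    adj≡ : ∀ i j → adj G (f i) (f j) ≡ neq i j
    adj≡ i j with i ≟ j
    ... | yes refl = irrefl G (f i)
    ... | no i≢j   = edge i≢j

  starCopy : ∀ {m} c (leaf : Fin m → V) → (∀ i → c ~ leaf i) → (∀ {i j} → leaf i ≡ leaf j → i ≡ j) →
             (∀ i j → ¬ leaf i ~ leaf j) → InducedCopy (star m) G
  starCopy {m} c leaf spoke leaf-inj indep = f , f-inj , adj≡
    where
    f : Fin (suc m) → V
    f zero    = c
    f (suc i) = leaf i

    f-inj : ∀ i j → f i ≡ f j → i ≡ j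
    f-inj zero    zero    _ = refl
    f-inj zero    (suc j) e = ⊥-elim (~⇒≢ (spoke j) e)
    f-inj (suc i) zero    e = ⊥-elim (~⇒≢ (spoke i) (sym e))
    f-inj (suc i) (suc j) e = cong suc (leaf-inj e)

    adj≡ : ∀ i j → adj G (f i) (f j) ≡ adj (star m) i j
    adj≡ zero    zero    = irrefl G c
    adj≡ zero    (suc j) = spoke j
    adj≡ (suc i) zero    = ~-sym (spoke i)
    adj≡ (suc i) (suc j) = ¬-not (indep i j)

  -- A triangle has no nonadjacent pair of distinct vertices, so it can never be heavy.
  C3-heavy⇒triangle-free : Heavy C3 G → ∀ {u v w} → u ~ v → v ~ w → u ~ w → ⊥
  C3-heavy⇒triangle-free heavy {u} {v} {w} uv vw uw =
    let i , j , i≢j , ≁ , _ = heavy (completeCopy corner edge) in not-¬ (edge i≢j) ≁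
    where
    corner : Fin 3 → V
    corner 0F = u
    corner 1F = v
    corner 2F = w

    edge : ∀ {i j} → i ≢ j → corner i ~ corner j
    edge {0F} {0F} i≢i = ⊥-elim (i≢i refl)
    edge {0F} {1F} _   = uv
    edge {0F} {2F} _   = uw
    edge {1F} {0F} _   = ~-sym uv
    edge {1F} {1F} i≢i = ⊥-elim (i≢i refl)
    edge {1F} {2F} _   = vw
    edge {2F} {0F} _   = ~-sym uw
    edge {2F} {1F} _   = ~-sym vw
    edge {2F} {2F} i≢i = ⊥-elim (i≢i refl)

K13×C3-heavy⇒traceable : ∀ G → Connected G → Heavy K13 G → Heavy C3 G → Traceable G
K13×C3-heavy⇒traceable G conn K13-heavy C3-heavy = traceable triangle-free claw-heavy
  where
  open Neighbours G
  open Dense G conn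

  triangle-free : ∀ {u v w} → u ~ v → v ~ w → u ~ w → ⊥
  triangle-free = C3-heavy⇒triangle-free G C3-heavy

  heavyPair : ∀ {a b} → n G ∸ 1 ≤ deg G a + deg G b → HeavyPair a b
  heavyPair {a} {b} h = ≤-trans (m≤n+m∸n (n G) 1) (s≤s (≤-trans h (≤-reflexive (cong₂ _+_ (deg≡d a) (deg≡d b)))))

  claw-heavy : ∀ {v a b c} → v ~ a → v ~ b → v ~ c → a ≢ b → a ≢ c → b ≢ c →
               HeavyPair a b ⊎ HeavyPair a c ⊎ HeavyPair b c
  claw-heavy {v} {a} {b} {c} va vb vc a≢b a≢c b≢c = pick (K13-heavy (starCopy G v leaf spoke leaf-inj indep))
    where
    leaf : Fin 3 → V
    leaf 0F = a
    leaf 1F = b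
    leaf 2F = c

    spoke : ∀ i → v ~ leaf i
    spoke 0F = va
    spoke 1F = vb
    spoke 2F = vc

    leaf-inj : ∀ {i j} → leaf i ≡ leaf j → i ≡ j
    leaf-inj {0F} {0F} _ = refl
    leaf-inj {0F} {1F} e = ⊥-elim (a≢b e)
    leaf-inj {0F} {2F} e = ⊥-elim (a≢c e)
    leaf-inj {1F} {0F} e = ⊥-elim (a≢b (sym e))
    leaf-inj {1F} {1F} _ = refl
    leaf-inj {1F} {2F} e = ⊥-elim (b≢c e)
    leaf-inj {2F} {0F} e = ⊥-elim (a≢c (sym e))
    leaf-inj {2F} {1F} e = ⊥-elim (b≢c (sym e))
    leaf-inj {2F} {2F} _ = refl

    indep : ∀ i j → ¬ leaf i ~ leaf j
    indep i j ij = triangle-free (spoke i) ij (spoke j)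

    flip : ∀ {a b} → HeavyPair a b → HeavyPair b a
    flip {a} {b} h = ≤-trans h (s≤s (≤-reflexive (+-comm (d a) (d b))))

    f : Fin 4 → V
    f = proj₁ (starCopy G v leaf spoke leaf-inj indep)

    pick : (∃₂ λ i j → i ≢ j × adj G (f i) (f j) ≡ false × n G ∸ 1 ≤ deg G (f i) + deg G (f j)) →
           HeavyPair a b ⊎ HeavyPair a c ⊎ HeavyPair b c
    -- The centre is adjacent to all leaves, so the heavy pair consists of two leaves.
    pick (0F , 0F , i≢i , _) = ⊥-elim (i≢i refl)
    pick (0F , suc j , _ , ≁ , _) = ⊥-elim (not-¬ (spoke j) ≁)
    pick (suc i , 0F , _ , ≁ , _) = ⊥-elim (not-¬ (~-sym (spoke i)) ≁)
    pick (1F , 1F , i≢i , _) = ⊥-elim (i≢i refl)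
    pick (1F , 2F , _ , _ , h) = inj₁ (heavyPair h)
    pick (1F , 3F , _ , _ , h) = inj₂ (inj₁ (heavyPair h))
    pick (2F , 1F , _ , _ , h) = inj₁ (flip (heavyPair h))
    pick (2F , 2F , i≢i , _) = ⊥-elim (i≢i refl)
    pick (2F , 3F , _ , _ , h) = inj₂ (inj₂ (heavyPair h))
    pick (3F , 1F , _ , _ , h) = inj₂ (inj₁ (flip (heavyPair h)))
    pick (3F , 2F , _ , _ , h) = inj₂ (inj₂ (flip (heavyPair h)))
    pick (3F , 3F , i≢i , _) = ⊥-elim (i≢i refl)

-- Induced paths on three vertices

module _ (H : Graph) where

  open Neighbours H

  record InducedPath : Set where
    field
      {u c w} : V
      uc  : u ~ c
      cw  : c ~ w
      u≢w : u ≢ w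
      u≁w : ¬ u ~ w

  -- `z` may be adjacent to any nonempty set of path vertices, so this covers every connected
  -- noncomplete graph on four vertices at once.
  record ExtendedPath : Set where
    field
      path : InducedPath
    open InducedPath path public
    field
      z : V
      z≢u : z ≢ u
      z≢c : z ≢ c
      z≢w : z ≢ w
      attached : z ~ u ⊎ z ~ c ⊎ z ~ w

  -- For nonadjacent `u` and `v`, a walk from `u` to `v` leaves the closed neighbourhood of `u` by
  -- an edge from `c` to `w`. Then `c` is not `u`, and `u`, `c`, `w` form the path.
  complete⊎path : Connected H → (∀ {u v} → u ≢ v → u ~ v) ⊎ InducedPath
  complete⊎path conn with any? (λ u → any? λ v → ¬? (u ≟ v) ×-dec ¬? (u ~? v))
  ... | no none = inj₁ λ {u} {v} u≢v → edge u v u≢v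
    where
    edge : ∀ u v → u ≢ v → u ~ v
    edge u v u≢v with u ~? v
    ... | yes uv = uv
    ... | no u≁v = ⊥-elim (none (u , v , u≢v , u≁v))
  ... | yes (u , v , u≢v , u≁v)
    with boundary H (λ x → (x ≟ u) ⊎-dec (u ~? x)) (conn u v) (inj₁ refl) (λ { (inj₁ v≡u) → u≢v (sym v≡u) ; (inj₂ uv) → u≁v uv })
  ... | c , w , inj₁ refl , ¬w , cw = ⊥-elim (¬w (inj₂ cw))
  ... | c , w , inj₂ uc , ¬w , cw = inj₂ (record { uc = uc ; cw = cw ; u≢w = ¬w ∘ inj₁ ∘ sym ; u≁w = ¬w ∘ inj₂ })

  path⇒P3-copy : InducedPath → InducedCopy P3 H
  path⇒P3-copy π = starCopy H c leaf spoke leaf-inj indep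
    where
    open InducedPath π

    leaf : Fin 2 → V
    leaf 0F = u
    leaf 1F = w

    spoke : ∀ i → c ~ leaf i
    spoke 0F = ~-sym uc
    spoke 1F = cw

    leaf-inj : ∀ {i j} → leaf i ≡ leaf j → i ≡ j
    leaf-inj {0F} {0F} _ = refl
    leaf-inj {0F} {1F} e = ⊥-elim (u≢w e)
    leaf-inj {1F} {0F} e = ⊥-elim (u≢w (sym e))
    leaf-inj {1F} {1F} _ = refl

    indep : ∀ i j → ¬ leaf i ~ leaf j
    indep 0F 0F e = ~⇒≢ e refl
    indep 0F 1F e = u≁w e
    indep 1F 0F e = u≁w (~-sym e)
    indep 1F 1F e = ~⇒≢ e refl

  -- A walk from `u` to a fourth vertex `t` leaves the path by an edge, whose outer end is `z`.
  extend : Connected H → 4 ≤ n H → InducedPath → ExtendedPath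
  extend conn 4≤n π with complement ((~⇒≢ uc ∷ u≢w ∷ []) ∷ (~⇒≢ cw ∷ []) ∷ [] ∷ []) (∈-allFin u ∷ ∈-allFin c ∷ ∈-allFin w ∷ [])
    where open InducedPath π
  ... | [] , p = ⊥-elim (1+n≰n (≤-trans 4≤n (≤-reflexive (trans (sym length-allFin) (↭-length p)))))
  ... | t ∷ _ , p with Unique-resp-↭ p (Uniq.allFin⁺ (n H))
  ... | (_ ∷ _ ∷ u≢t ∷ _) ∷ (_ ∷ c≢t ∷ _) ∷ (w≢t ∷ _) ∷ _
    with boundary H (λ v → (v ≟ u) ⊎-dec (v ≟ c) ⊎-dec (v ≟ w)) (conn u t) (inj₁ refl)
           (λ { (inj₁ e) → u≢t (sym e) ; (inj₂ (inj₁ e)) → c≢t (sym e) ; (inj₂ (inj₂ e)) → w≢t (sym e) })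
    where open InducedPath π
  ... | y , z , y∈ , z∉ , yz = record
    { path = π ; z = z ; z≢u = z∉ ∘ inj₁ ; z≢c = z∉ ∘ inj₂ ∘ inj₁ ; z≢w = z∉ ∘ inj₂ ∘ inj₂ ; attached = attach y∈ }
    where
    open InducedPath π
    attach : y ≡ u ⊎ y ≡ c ⊎ y ≡ w → z ~ u ⊎ z ~ c ⊎ z ~ w
    attach (inj₁ refl)        = inj₁ (~-sym yz)
    attach (inj₂ (inj₁ refl)) = inj₂ (inj₁ (~-sym yz))
    attach (inj₂ (inj₂ refl)) = inj₂ (inj₂ (~-sym yz))

-- Untraceable graphs

reach-trans : ∀ {G u v w} → Reach G u v → Reach G v w → Reach G u w
reach-trans r here       = r
reach-trans r (step q e) = step (reach-trans r q) e

reach-sym : ∀ {G u v} → Reach G u v → Reach G v u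
reach-sym     here               = here
reach-sym {G} (step {v} {w} r e) = reach-trans (step here (trans (Graph.sym G w v) e)) (reach-sym r)

module _ (G : Graph) where

  open Neighbours G

  -- A certificate of connectedness that evaluation can check; three parent steps suffice for all
  -- graphs below.
  rooted⇒connected : ∀ r (parent : V → V) → (∀ v → v ≡ r ⊎ v ~ parent v) →
                     (∀ v → parent (parent (parent v)) ≡ r) → Connected G
  rooted⇒connected r parent up top u v = reach-trans (toRoot u) (reach-sym (toRoot v))
    where
    climb : ∀ {v} → Reach G (parent v) r → Reach G v r
    climb {v} q with up v
    ... | inj₁ refl = here
    ... | inj₂ e    = reach-trans (step here e) q

    toRoot : ∀ v → Reach G v r
    toRoot v = climb (climb (climb (subst (λ x → Reach G x r) (sym (top v)) here)))

  Pendant : V → Set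
  Pendant u = ∃ λ a → ∀ v → u ~ v → v ≡ a

  -- An inner vertex of a path has two distinct neighbours, so each pendant vertex is an end; three
  -- of them do not fit into two ends.
  threePendants : ∀ {u v w} → Pendant u → Pendant v → Pendant w → u ≢ v → u ≢ w → v ≢ w → ¬ Traceable G
  threePendants pu pv pw u≢v u≢w v≢w (p , up , cover , lp) = clash (end pu) (end pv) (end pw)
    where
    End : V → Set
    End x = (∃ λ ys → p ≡ x ∷ ys) ⊎ (∃ λ xs → p ≡ xs ∷ʳ x)

    end : ∀ {x} → Pendant x → End x
    end {x} (a , only) with position up lp (cover x)
    ... | first e                = inj₁ (_ , e)
    ... | last e                 = inj₂ (_ , e)
    ... | inner a≢b _ _ ax xb    = ⊥-elim (a≢b (trans (only _ (~-sym ax)) (sym (only _ xb))))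

    sameHead : ∀ {x y} → (∃ λ ys → p ≡ x ∷ ys) → (∃ λ ys → p ≡ y ∷ ys) → x ≡ y
    sameHead (_ , e) (_ , e′) = ∷-injectiveˡ (trans (sym e) e′)

    sameLast : ∀ {x y} → (∃ λ xs → p ≡ xs ∷ʳ x) → (∃ λ xs → p ≡ xs ∷ʳ y) → x ≡ y
    sameLast (xs , e) (ys , e′) = ∷ʳ-injectiveʳ xs ys (trans (sym e) e′)

    clash : End _ → End _ → End _ → ⊥
    clash (inj₁ u) (inj₁ v) _        = u≢v (sameHead u v)
    clash (inj₁ u) (inj₂ v) (inj₁ w) = u≢w (sameHead u w)
    clash (inj₁ u) (inj₂ v) (inj₂ w) = v≢w (sameLast v w)
    clash (inj₂ u) (inj₂ v) _        = u≢v (sameLast u v)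
    clash (inj₂ u) (inj₁ v) (inj₂ w) = u≢w (sameLast u w)
    clash (inj₂ u) (inj₁ v) (inj₁ w) = v≢w (sameHead v w)

  pendant? : ∀ u a → Dec (∀ v → u ~ v → v ≡ a)
  pendant? u a = all? (λ v → (u ~? v) →-dec (v ≟ a))

-- `E` is read symmetrically. A class becomes a clique if `E` relates it to itself and an
-- independent set otherwise.
blowup : ∀ {m k} → (Fin m → Fin k) → (Fin k → Fin k → Bool) → Graph
blowup {m} cls E = record
  { n      = m
  ; adj    = λ u v → neq u v ∧ (E (cls u) (cls v) ∨ E (cls v) (cls u))
  ; sym    = λ u v → cong₂ _∧_ (neq-sym u v) (∨-comm (E (cls u) (cls v)) (E (cls v) (cls u)))
  ; irrefl = λ v → cong (_∧ (E (cls v) (cls v) ∨ E (cls v) (cls v))) (neq-irr v)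
  }

K13-connected : Connected K13
K13-connected = rooted⇒connected K13 0F (λ _ → 0F) (λ { 0F → inj₁ refl ; (suc _) → inj₂ refl }) (λ _ → refl)

K13-untraceable : ¬ Traceable K13
K13-untraceable = threePendants K13 {1F} {2F} {3F} (pendant 0F) (pendant 1F) (pendant 2F) (λ ()) (λ ()) (λ ())
  where
  pendant : ∀ i → Pendant K13 (suc i)
  pendant i = 0F , λ { 0F _ → refl }

K13-triangle-free : ¬ InducedCopy C3 K13
K13-triangle-free (f , _ , adj≡) = no-triangle (f 0F) (f 1F) (f 2F) (adj≡ 0F 1F) (adj≡ 1F 2F) (adj≡ 0F 2F)
  where
  no-triangle : ∀ u v w → adj K13 u v ≡ true → adj K13 v w ≡ true → adj K13 u w ≡ true → ⊥
  no-triangle 0F      0F      _       ()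
  no-triangle 0F      (suc _) 0F      _ _ ()
  no-triangle 0F      (suc _) (suc _) _ ()
  no-triangle (suc _) 0F      0F      _ ()
  no-triangle (suc _) 0F      (suc _) _ _ ()
  no-triangle (suc _) (suc _) _       ()

netEdge : Fin 6 → Fin 6 → Bool
netEdge 0F 1F = true
netEdge 0F 2F = true
netEdge 1F 2F = true
netEdge 0F 3F = true
netEdge 1F 4F = true
netEdge 2F 5F = true
netEdge _  _  = false

net : Graph
net = blowup id netEdge

net-connected : Connected net
net-connected = rooted⇒connected net 0F parent (toWitness {a? = up?} tt) (toWitness {a? = top?} tt)
  where
  parent : Fin 6 → Fin 6
  parent 4F = 1F
  parent 5F = 2F
  parent _  = 0F

  up? = all? (λ v → (v ≟ 0F) ⊎-dec (adj net v (parent v) Bool.≟ true))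
  top? = all? (λ v → parent (parent (parent v)) ≟ 0F)

net-untraceable : ¬ Traceable net
net-untraceable = threePendants net {3F} {4F} {5F}
  (0F , toWitness {a? = pendant? net 3F 0F} tt)
  (1F , toWitness {a? = pendant? net 4F 1F} tt)
  (2F , toWitness {a? = pendant? net 5F 2F} tt) (λ ()) (λ ()) (λ ())

net-claw-free : ¬ InducedCopy K13 net
net-claw-free (f , f-inj , adj≡) = toWitness {a? = claw-free?} tt
  (f 0F) (f 1F) (adj≡ 0F 1F) (f 2F) (adj≡ 0F 2F) ((λ ()) ∘ f-inj 1F 2F) (adj≡ 1F 2F)
  (f 3F) (adj≡ 0F 3F) ((λ ()) ∘ f-inj 1F 3F) ((λ ()) ∘ f-inj 2F 3F) (adj≡ 1F 3F) (adj≡ 2F 3F)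
  where
  -- Each condition stands before the next quantifier, so that the exhaustive check prunes early.
  claw-free? = all? λ c → all? λ u → (adj net c u Bool.≟ true) →-dec all? λ v → (adj net c v Bool.≟ true) →-dec
               ¬? (u ≟ v) →-dec (adj net u v Bool.≟ false) →-dec all? λ w → (adj net c w Bool.≟ true) →-dec
               ¬? (u ≟ w) →-dec ¬? (v ≟ w) →-dec (adj net u w Bool.≟ false) →-dec ¬? (adj net v w Bool.≟ false)

net-K4-free : ¬ InducedCopy (complete 4) net
net-K4-free (f , _ , adj≡) = toWitness {a? = K4-free?} tt
  (f 0F) (f 1F) (adj≡ 0F 1F) (f 2F) (adj≡ 0F 2F) (adj≡ 1F 2F) (f 3F) (adj≡ 0F 3F) (adj≡ 1F 3F) (adj≡ 2F 3F)
  where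
  K4-free? = all? λ t → all? λ u → (adj net t u Bool.≟ true) →-dec all? λ v → (adj net t v Bool.≟ true) →-dec
             (adj net u v Bool.≟ true) →-dec all? λ w → (adj net t w Bool.≟ true) →-dec
             (adj net u w Bool.≟ true) →-dec ¬? (adj net v w Bool.≟ true)

-- For i < 3: a pendant vertex (class i) on a vertex aᵢ (class 3 + i), which is joined to an independent set Xᵢ
-- (class 6 + i); all Xᵢ are joined to a clique Y (class 9).  The sizes |Xᵢ| = 5 and |Y| = 18 make the nonadjacent pairs
-- in X₀ ∪ X₁ ∪ X₂ and the pairs aᵢ, y heavy: 19 + 19 = 6 + 32 = 38 = n − 1.
classEdge : Fin 10 → Fin 10 → Bool
classEdge 0F 3F = true
classEdge 1F 4F = true
classEdge 2F 5F = true
classEdge 3F 6F = true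
classEdge 4F 7F = true
classEdge 5F 8F = true
classEdge 6F 9F = true
classEdge 7F 9F = true
classEdge 8F 9F = true
classEdge 9F 9F = true
classEdge _  _  = false

classes : Vec (Fin 10) 39
classes = 0F Vec.∷ 1F Vec.∷ 2F Vec.∷ 3F Vec.∷ 4F Vec.∷ 5F Vec.∷
          replicate 5 6F Vec.++ replicate 5 7F Vec.++ replicate 5 8F Vec.++ replicate 18 9F

big : Graph
big = blowup (lookup classes) classEdge

-- The degrees are 1 for pendant vertices, 1 + 5 for aᵢ, 1 + 18 in Xᵢ and 15 + 17 in Y.
classDegree : Fin 10 → ℕ
classDegree = lookup (1 Vec.∷ 1 Vec.∷ 1 Vec.∷ 6 Vec.∷ 6 Vec.∷ 6 Vec.∷ 19 Vec.∷ 19 Vec.∷ 19 Vec.∷ 32 Vec.∷ Vec.[])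

big-degree : ∀ v → deg big v ≡ classDegree (lookup classes v)
big-degree = toWitness {a? = all? (λ v → deg big v ℕ.≟ classDegree (lookup classes v))} tt

_joined_ : (c e : Fin 10) → Bool
c joined e = classEdge c e ∨ classEdge e c

-- Classes 0–5 have a single vertex, so distinct vertices lie in distinct classes or in a class from 6 on.
Apart : Fin 10 → Fin 10 → Set
Apart c e = c ≢ e ⊎ 6 ≤ toℕ c

apart? : ∀ c e → Dec (Apart c e)
apart? c e = ¬? (c ≟ e) ⊎-dec (6 ≤? toℕ c)

HeavyClasses : Fin 10 → Fin 10 → Set
HeavyClasses c e = (c joined e) ≡ false × 38 ≤ classDegree c + classDegree e

heavyClasses? : ∀ c e → Dec (HeavyClasses c e)
heavyClasses? c e = ((c joined e) Bool.≟ false) ×-dec (38 ≤? classDegree c + classDegree e)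

distinct⇒apart : ∀ u v → u ≢ v → Apart (lookup classes u) (lookup classes v)
distinct⇒apart = toWitness {a? = all? λ u → all? λ v → ¬? (u ≟ v) →-dec apart? (lookup classes u) (lookup classes v)} tt

-- The only induced paths with a light pair of ends join a pendant vertex to Xᵢ through aᵢ. A
-- further vertex attached to one lies in Xᵢ, heavy with the end in Xᵢ, or in Y, heavy with the
-- middle aᵢ. Working with classes keeps the search small.
extendedPath-heavyClasses : ∀ u c w z → (u joined c) ≡ true → (c joined w) ≡ true → (u joined w) ≡ false → Apart u w →
  (z joined u) ≡ true ⊎ (z joined c) ≡ true ⊎ (z joined w) ≡ true → Apart z u → Apart z c → Apart z w →
  HeavyClasses u w ⊎ HeavyClasses z u ⊎ HeavyClasses z c ⊎ HeavyClasses z w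
extendedPath-heavyClasses u c w z uc cw uw u≢w at z≢u z≢c z≢w = toWitness {a? = path?} tt u c uc w cw uw u≢w z at z≢u z≢c z≢w
  where
  path? = all? λ u → all? λ c → ((u joined c) Bool.≟ true) →-dec all? λ w → ((c joined w) Bool.≟ true) →-dec
          ((u joined w) Bool.≟ false) →-dec apart? u w →-dec all? λ z →
          (((z joined u) Bool.≟ true) ⊎-dec ((z joined c) Bool.≟ true) ⊎-dec ((z joined w) Bool.≟ true)) →-dec
          apart? z u →-dec apart? z c →-dec apart? z w →-dec
          (heavyClasses? u w ⊎-dec heavyClasses? z u ⊎-dec heavyClasses? z c ⊎-dec heavyClasses? z w)

big-connected : Connected big
big-connected = rooted⇒connected big root parent (toWitness {a? = up?} tt) (toWitness {a? = top?} tt)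
  where
  root : Fin 39
  root = # 38

  -- Vertices 6, 11 and 16 are the first of X₀, X₁ and X₂, and the root lies in Y.
  classParent : Vec (Fin 39) 10
  classParent = 3F Vec.∷ 4F Vec.∷ 5F Vec.∷ 6F Vec.∷ # 11 Vec.∷ # 16 Vec.∷ root Vec.∷ root Vec.∷ root Vec.∷ root Vec.∷ Vec.[]

  parent : Fin 39 → Fin 39
  parent v = lookup classParent (lookup classes v)

  up? = all? (λ v → (v ≟ root) ⊎-dec (adj big v (parent v) Bool.≟ true))
  top? = all? (λ v → parent (parent (parent v)) ≟ root)

big-untraceable : ¬ Traceable big
big-untraceable = threePendants big {0F} {1F} {2F}
  (3F , toWitness {a? = pendant? big 0F 3F} tt)
  (4F , toWitness {a? = pendant? big 1F 4F} tt)
  (5F , toWitness {a? = pendant? big 2F 5F} tt) (λ ()) (λ ()) (λ ())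

blowup-distinct : ∀ {m k} (cls : Fin m → Fin k) E {u v} → u ≢ v →
                  adj (blowup cls E) u v ≡ E (cls u) (cls v) ∨ E (cls v) (cls u)
blowup-distinct cls E u≢v rewrite neq-≢ u≢v = refl

-- In `big`, degrees and the adjacency of distinct vertices depend only on classes, so a copy of the
-- extended path is judged by the classes of its four vertices.
extendedPath⇒heavy : ∀ H → ExtendedPath H → Heavy H big
extendedPath⇒heavy H π (f , f-inj , adj≡) = pick
  (extendedPath-heavyClasses (κ u) (κ c) (κ w) (κ z) (same (~⇒≢ uc) uc) (same (~⇒≢ cw) cw) (same u≢w (¬-not u≁w)) (apart u≢w)
    (attach attached) (apart z≢u) (apart z≢c) (apart z≢w))
  where
  open Neighbours H
  open ExtendedPath π

  κ : V → Fin 10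
  κ v = lookup classes (f v)

  classwise : ∀ {x y} → x ≢ y → adj H x y ≡ (κ x joined κ y)
  classwise x≢y = trans (sym (adj≡ _ _)) (blowup-distinct (lookup classes) classEdge (x≢y ∘ f-inj _ _))

  same : ∀ {x y b} → x ≢ y → adj H x y ≡ b → (κ x joined κ y) ≡ b
  same x≢y e = trans (sym (classwise x≢y)) e

  apart : ∀ {x y} → x ≢ y → Apart (κ x) (κ y)
  apart x≢y = distinct⇒apart _ _ (x≢y ∘ f-inj _ _)

  attach : z ~ u ⊎ z ~ c ⊎ z ~ w → (κ z joined κ u) ≡ true ⊎ (κ z joined κ c) ≡ true ⊎ (κ z joined κ w) ≡ true
  attach (inj₁ zu)        = inj₁ (same z≢u zu)
  attach (inj₂ (inj₁ zc)) = inj₂ (inj₁ (same z≢c zc))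
  attach (inj₂ (inj₂ zw)) = inj₂ (inj₂ (same z≢w zw))

  Goal : Set
  Goal = ∃₂ λ x y → x ≢ y × adj big (f x) (f y) ≡ false × 38 ≤ deg big (f x) + deg big (f y)

  found : ∀ {x y} → x ≢ y → HeavyClasses (κ x) (κ y) → Goal
  found {x} {y} x≢y (≉ , h) = x , y , x≢y , trans (adj≡ _ _) (trans (classwise x≢y) ≉) ,
    ≤-trans h (≤-reflexive (sym (cong₂ _+_ (big-degree (f x)) (big-degree (f y)))))

  pick : HeavyClasses (κ u) (κ w) ⊎ HeavyClasses (κ z) (κ u) ⊎ HeavyClasses (κ z) (κ c) ⊎ HeavyClasses (κ z) (κ w) → Goal
  pick (inj₁ h)               = found u≢w h
  pick (inj₂ (inj₁ h))        = found z≢u h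
  pick (inj₂ (inj₂ (inj₁ h))) = found z≢c h
  pick (inj₂ (inj₂ (inj₂ h))) = found z≢w h

-- The claw is an extended path: two leaves joined through the centre, with the third leaf attached
-- there.
K13-heavy-big : Heavy K13 big
K13-heavy-big = extendedPath⇒heavy K13 (record
  { path = record { u = 1F ; c = 0F ; w = 2F ; uc = refl ; cw = refl ; u≢w = λ () ; u≁w = λ () }
  ; z = 3F ; z≢u = λ () ; z≢c = λ () ; z≢w = λ () ; attached = inj₂ (inj₁ refl) })

-- Which pairs force traceability

module _ (H : Graph) (conn : Connected H) (3≤n : 3 ≤ n H) (H≇P3 : ¬ Iso H P3) where

  completeSub : (∀ {u v} → u ≢ v → adj H u v ≡ true) → ∀ {m} → m ≤ n H → InducedCopy (complete m) H
  completeSub edge m≤n = completeCopy H (λ i → inject≤ i m≤n) (λ i≢j → edge (i≢j ∘ inject≤-injective m≤n m≤n _ _))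

  path⇒4≤n : InducedPath H → 4 ≤ n H
  path⇒4≤n π = ≤∧≢⇒< 3≤n λ 3≡n → H≇P3 (iso-sym P3 H (copy⇒iso P3 H (path⇒P3-copy H π) 3≡n))

  -- If `H` has no copy in the claw, heaviness is vacuous. Otherwise `H` is not complete, the claw
  -- being triangle-free; it then has at least four vertices and fills the claw.
  iso-K13⊎heavy : Iso H K13 ⊎ Heavy H K13
  iso-K13⊎heavy with copy? H K13
  ... | no none = inj₂ (⊥-elim ∘ none)
  ... | yes copy with complete⊎path H conn
  ... | inj₁ edge = ⊥-elim (K13-triangle-free (copy-∘ C3 H K13 (completeSub edge 3≤n) copy))
  ... | inj₂ π = inj₁ (copy⇒iso H K13 copy (≤-antisym (injective⇒≤ (λ {x} {y} → proj₁ (proj₂ copy) x y)) (path⇒4≤n π)))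

  -- The counterexample must be claw-heavy as well, since the other graph of the pair is the claw.
  -- For the net both heaviness conditions hold vacuously.
  iso-C3⊎untraceable : Iso H C3 ⊎ ∃ λ G → Connected G × ¬ Traceable G × Heavy K13 G × Heavy H G
  iso-C3⊎untraceable with complete⊎path H conn
  ... | inj₂ π = inj₂ (big , big-connected , big-untraceable , K13-heavy-big ,
                       extendedPath⇒heavy H (extend H conn (path⇒4≤n π) π))
  ... | inj₁ edge with 3 ℕ.≟ n H
  ... | yes 3≡n = inj₁ (iso-sym C3 H (copy⇒iso C3 H (completeSub edge 3≤n) 3≡n))
  ... | no 3≢n  = inj₂ (net , net-connected , net-untraceable , ⊥-elim ∘ net-claw-free ,
                         ⊥-elim ∘ net-K4-free ∘ copy-∘ (complete 4) H net (completeSub edge (≤∧≢⇒< 3≤n 3≢n)))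

theorem6 : (R S : Graph) → Connected R → Connected S → 3 ≤ n R → 3 ≤ n S →
    ¬ Iso R P3 → ¬ Iso S P3 →
    (((G : Graph) → Connected G → Heavy R G → Heavy S G → Traceable G) ⇔
    ((Iso R K13 × Iso S C3) ⊎ (Iso R C3 × Iso S K13)))
theorem6 R S connR connS 3≤R 3≤S R≇P3 S≇P3 = mk⇔ necessary sufficient
  where
  necessary : ((G : Graph) → Connected G → Heavy R G → Heavy S G → Traceable G) →
              (Iso R K13 × Iso S C3) ⊎ (Iso R C3 × Iso S K13)
  necessary H with iso-K13⊎heavy R connR 3≤R R≇P3 | iso-K13⊎heavy S connS 3≤S S≇P3
  -- The claw itself is then an untraceable counterexample.
  ... | inj₂ hR | inj₂ hS = ⊥-elim (K13-untraceable (H K13 K13-connected hR hS))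
  ... | inj₁ R≅ | _ with iso-C3⊎untraceable S connS 3≤S S≇P3
  ...   | inj₁ S≅ = inj₁ (R≅ , S≅)
  ...   | inj₂ (G , conn , untraceable , hK , hS) =
          ⊥-elim (untraceable (H G conn (heavy-resp-iso K13 R G (iso-sym R K13 R≅) hK) hS))
  necessary H | inj₂ _ | inj₁ S≅ with iso-C3⊎untraceable R connR 3≤R R≇P3
  ...   | inj₁ R≅ = inj₂ (R≅ , S≅)
  ...   | inj₂ (G , conn , untraceable , hK , hR) =
          ⊥-elim (untraceable (H G conn hR (heavy-resp-iso K13 S G (iso-sym S K13 S≅) hK)))

  sufficient : (Iso R K13 × Iso S C3) ⊎ (Iso R C3 × Iso S K13) →
               (G : Graph) → Connected G → Heavy R G → Heavy S G → Traceable G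
  sufficient (inj₁ (R≅ , S≅)) G conn hR hS =
    K13×C3-heavy⇒traceable G conn (heavy-resp-iso R K13 G R≅ hR) (heavy-resp-iso S C3 G S≅ hS)
  sufficient (inj₂ (R≅ , S≅)) G conn hR hS =
    K13×C3-heavy⇒traceable G conn (heavy-resp-iso S K13 G S≅ hS) (heavy-resp-iso R C3 G R≅ hR)
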